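{- Let $X\subseteq U$ be a fixed set of $|X|=m$ keys (balls), let $h:U\to[n]$ be a simple tabulation hash function, and let $y\in[n]$ be any fixed bin. If $p$ denotes the probability that $y\in h(X)$, then $$|p-p_0|\le \frac{m^{2-1/c}}{n^2},\qquad\text{and hence}\qquad \bigl|\mathbb{E}[|h(X)|]-\mu_0\bigr|\le \frac{m^{2-1/c}}{n}.$$ Moreover, if $q\in U\setminus X$ is a distinguished query key and the bin $y$ is allowed to depend on $h(q)$ (e.g. $y=h(q)$), i.e. for every $z\in[n]$, conditioned on $h(q)=z$ the bin $y$ is a fixed function of $z$ and $p$ denotes the conditional probability that $y\in h(X)$, then the weaker bound $|p-p_0|\le \frac{2m^{2-1/c}}{n^2}$ holds.
   Context: Simple tabulation hashing: the key universe is $U=[u]=\{0,\dots,u-1\}$, and each key $x\in U$ is viewed as a vector $(x[0],\dots,x[c-1])$ of $c=O(1)$ characters, each $x[i]\in\Sigma=[u^{1/c}]$. The range is $[n]=[2^r]$, viewed as $r$-bit strings. A simple tabulation hash function is $h(x)=h_0(x[0])\oplus\cdots\oplus h_{c-1}(x[c-1])$, where $h_0,\dots,h_{c-1}:\Sigma\to[2^r]$ are independent fully random functions and $\oplus$ is bitwise XOR. Notation: $p_0=1-(1-1/n)^m$ and $\mu_0=np_0$ (the probability a given bin is non-empty, resp. the expected number of non-empty bins, when $m$ balls are hashed fully randomly into $n$ bins). -}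

module Defs where

open import Algebra.Definitions.RawMonoid using () renaming (sum to monoidSum)
open import Algebra.Definitions.RawSemiring using () renaming (_^_ to semiringPow)
open import Data.Bool.Base using (if_then_else_)
open import Data.Fin.Base using (Fin; zero; suc; finToFun; funToFin; opposite)
open import Data.Fin.Properties using (any?) renaming (_≟_ to _≟ᶠ_)
open import Data.Fin.Subset using (Subset)
open import Data.Fin.Subset.Properties using (_∈?_)
open import Data.Integer.Base using (+_)
open import Data.Nat.Base as ℕ using (ℕ; NonZero)
open import Data.Nat.Properties using (m^n≢0)
open import Data.Rational.Base using (ℚ; 0ℚ; 1ℚ; _-_; _*_; _/_; _÷_; _≤_; ≢-nonZero; +-0-rawMonoid; +-*-rawSemiring)
open import Data.Rational.Properties using (_≟_)
open import Data.Vec.Base using (tabulate)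
open import Data.Vec.Functional using (foldr)
open import Level using (0ℓ)
open import Relation.Nullary.Decidable using (does; yes; no; _×-dec_)
open import Relation.Unary using (Pred; Decidable)

infixr 8 _^ℚ_

_^ℚ_ : ℚ → ℕ → ℚ
_^ℚ_ = semiringPow +-*-rawSemiring

fromℕ : ℕ → ℚ
fromℕ k = + k / 1

-- A real number x is represented by the set of rationals q with q ≤ x;
-- this is enough to compare a rational with a possibly irrational bound.
LowerReal : Set₁
LowerReal = Pred ℚ 0ℓ

infix 4 _≤ʳ_

_≤ʳ_ : ℚ → LowerReal → Set
q ≤ʳ x = x q

-- The real number m^(a/b), i.e. the nonnegative b-th root of m^a.
infix 9 _^⟨_/_⟩

_^⟨_/_⟩ : (m a b : ℕ) .{{_ : NonZero b}} → LowerReal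
(m ^⟨ a / b ⟩) q = 0ℚ ≤ q → q ^ℚ b ≤ fromℕ (m ℕ.^ a)

infixl 7 _/ʳ_
infixr 7 _*ʳ_

_/ʳ_ : LowerReal → (d : ℕ) .{{_ : NonZero d}} → LowerReal
(x /ʳ d) q = x (q * fromℕ d)

_*ʳ_ : (k : ℕ) .{{_ : NonZero k}} → LowerReal → LowerReal
(k *ʳ x) q = x (q * (+ 1 / k))

-- Fin N carries the uniform distribution.
module _ {N : ℕ} .{{_ : NonZero N}} where

  𝔼 : (Fin N → ℚ) → ℚ
  𝔼 f = monoidSum +-0-rawMonoid f * (+ 1 / N)

  Pr : {A : Pred (Fin N) 0ℓ} → Decidable A → ℚ
  Pr A? = 𝔼 λ ω → if does (A? ω) then 1ℚ else 0ℚ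

  -- The value 0ℚ for a null conditioning event is a dummy.
  Pr[_∣_] : {A B : Pred (Fin N) 0ℓ} → Decidable A → Decidable B → ℚ
  Pr[ A? ∣ B? ] with Pr B? ≟ 0ℚ
  ... | yes _   = 0ℚ
  ... | no  B≢0 = _÷_ (Pr (λ ω → A? ω ×-dec B? ω)) (Pr B?) {{≢-nonZero B≢0}}

image : ∀ {u n} → (Fin u → Fin n) → Subset u → Subset n
image f X = tabulate λ y → does (any? λ x → (x ∈? X) ×-dec (f x ≟ᶠ y))

_⊕₂_ : Fin 2 → Fin 2 → Fin 2
zero     ⊕₂ b = b
suc zero ⊕₂ b = opposite b

-- Elements of [2^r] are r-bit strings through finToFun / funToFin.
0ʳ : ∀ {r} → Fin (2 ℕ.^ r)
0ʳ {r} = funToFin {r} λ _ → zero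

_⊕_ : ∀ {r} → Fin (2 ℕ.^ r) → Fin (2 ℕ.^ r) → Fin (2 ℕ.^ r)
_⊕_ {r} a b = funToFin {r} λ i → finToFun a i ⊕₂ finToFun b i

-- c characters from the alphabet Σ = [s], so that u = s ^ c.
module Tabulation (c s r : ℕ) where

  n : ℕ
  n = 2 ℕ.^ r

  Key : Set
  Key = Fin (s ℕ.^ c)

  Bin : Set
  Bin = Fin n

  _[_] : Key → Fin c → Fin s
  x [ i ] = finToFun x i

  -- Size of the set (Σ → [n])^c of all c-tuples of tables.  The uniform
  -- distribution on this set makes h₀, …, h_{c-1} independent and fully random.
  #Ω : ℕ
  #Ω = (n ℕ.^ s) ℕ.^ c

  instance
    n-nonZero : NonZero n
    n-nonZero = m^n≢0 2 r

    n²-nonZero : NonZero (n ℕ.^ 2)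
    n²-nonZero = m^n≢0 n 2

    #Ω-nonZero : NonZero #Ω
    #Ω-nonZero = m^n≢0 (n ℕ.^ s) c {{m^n≢0 n s}}

  table : Fin #Ω → Fin c → Fin s → Bin
  table ω i = finToFun (finToFun {n ℕ.^ s} {c} ω i)

  hash : Fin #Ω → Key → Bin
  hash ω x = foldr (_⊕_ {r}) (0ʳ {r}) λ i → table ω i (x [ i ])

p₀ : (n m : ℕ) .{{_ : NonZero n}} → ℚ
p₀ n m = 1ℚ - (1ℚ - + 1 / n) ^ℚ m

μ₀ : (n m : ℕ) .{{_ : NonZero n}} → ℚ
μ₀ n m = fromℕ n * p₀ n m

{-# OPTIONS --safe #-}

-- Remove the keys one at a time.  If a key x has a character (i , α) occurring in only a keys,
-- then a coarse two-term Bonferroni estimate shows that adding x multiplies the probability of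
-- missing y by 1 - 1/n, up to an error a/n²: apart from the other keys containing (i , α),
-- everything is independent of the uniform table entry at (i , α), and two such keys collide in
-- y with probability 1/n².  A set of m keys always has such a character with a ≤ m^(1-1/c),
-- because if every occurring character had more than m^(1-1/c) occurrences, each position would
-- show fewer than m^(1/c) characters, leaving room for fewer than m keys.  Summing the errors
-- gives m · m^(1-1/c) / n².  When h(q) is fixed, the characters of q may not be used; this
-- costs at most one character per position, hence the factor 2.

module Submission where

open import Defs
open import Algebra.Bundles using (CommutativeRing)
open import Algebra.Definitions.RawMonoid using (sum)
open import Algebra.Properties.CommutativeMonoid.Sum using (∑-distrib-+; ∑-comm; sum-permute)
open import Algebra.Properties.CommutativeSemiring.Exp using () renaming (^-distrib-* to semiring-^-distrib-*)
open import Algebra.Properties.Monoid.Sum using (sum-cong-≗)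
open import Algebra.Properties.Semiring.Sum using (*-distribˡ-sum; *-distribʳ-sum)
open import Data.Bool.Base using (true; if_then_else_)
open import Data.Fin.Base as Fin using (Fin; zero; suc; fromℕ<; finToFun; funToFin; combine)
open import Data.Fin.Permutation using (Permutation′; permutation; _⟨$⟩ʳ_)
open import Data.Fin.Properties as Fin using (_≟_; _<?_; _≤?_; any?; suc-injective; finToFun-funToFin; funToFin-finToFin; fromℕ<-injective; injective⇒≤; ¬∀⟶∃¬)
open import Data.Fin.Subset using (Subset; inside; outside; ∣_∣) renaming (_∈_ to _∈ˢ_; _∉_ to _∉ˢ_)
open import Data.Fin.Subset.Properties using (_∈?_; drop-there)
open import Data.Integer.Base as ℤ using (+_)
import Data.Integer.Properties as ℤ
open import Data.List.Base using (List; []; _∷_; _++_; length; map; filter; lookup; allFin; cartesianProduct)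
open import Data.List.Extrema.Nat using (argmin; argmin-all; f[argmin]≤f[xs])
open import Data.List.Membership.Propositional using (_∈_; _∉_)
open import Data.List.Membership.Propositional.Properties using (∈-lookup; ∈-filter⁺; ∈-filter⁻; ∈-allFin; ∈-cartesianProduct⁺; ∈-cartesianProduct⁻; ∈-∃++; ∈-map⁺; ∈-map⁻)
open import Data.List.Properties using (length-filter; length-map; filter-some)
open import Data.List.Relation.Binary.Permutation.Propositional as ↭ using (_↭_; ↭-sym; ↭⇒↭ₛ)
open import Data.List.Relation.Binary.Permutation.Propositional.Properties using (∈-resp-↭; ↭-length; filter-↭) renaming (shift to ↭-shift)
import Data.List.Relation.Binary.Permutation.Setoid.Properties as Permutation
open import Data.List.Relation.Unary.All as All using (All; []; _∷_)
import Data.List.Relation.Unary.All.Properties as All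
open import Data.List.Relation.Unary.AllPairs using ([]; _∷_; tail)
open import Data.List.Relation.Unary.Any as Any using (here; there)
open import Data.List.Relation.Unary.Unique.Propositional using (Unique)
import Data.List.Relation.Unary.Unique.Propositional.Properties as Unique
open import Data.Maybe.Base using (Maybe; just; nothing; maybe)
open import Data.Maybe.Relation.Unary.All as Maybe using (just; nothing)
open import Data.Nat.Base as ℕ using (ℕ; zero; suc; NonZero; s≤s; z≤n; >-nonZero)
open import Data.Nat.DivMod using (m/n*n≤m; /-monoˡ-≤; m/n≡1+[m∸n]/n)
import Data.Nat.Properties as ℕ
open import Data.Product.Base using (_×_; _,_; ∃; ∃₂; proj₁; proj₂)
open import Data.Rational.Base as ℚ using (ℚ; 0ℚ; 1ℚ; _+_; _-_; -_; _*_; _/_; _≤_; 1/_; toℚᵘ; nonNegative; positive; +-0-rawMonoid) renaming (∣_∣ to abs)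
open import Data.Rational.Properties as ℚ using (+-0-commutativeMonoid; +-*-commutativeRing)
open import Data.Rational.Solver using (module +-*-Solver)
open import Data.Rational.Unnormalised.Base as ℚᵘ using (mkℚᵘ; *≡*; *≤*)
import Data.Rational.Unnormalised.Properties as ℚᵘ
open import Data.Sum.Base using (inj₁; inj₂)
open import Data.Vec.Base using ([]; _∷_; here; there)
open import Data.Vec.Functional using (Vector; foldr; updateAt)
open import Data.Vec.Functional.Properties using (updateAt-updates; updateAt-minimal)
import Data.Vec.Functional.Relation.Binary.Pointwise.Properties as Pointwise
open import Data.Vec.Properties using ([]=⇒lookup; lookup⇒[]=; lookup∘tabulate)
open import Function.Base using (_∘_)
open import Function.Definitions using (Injective)
open import Level using (0ℓ)
open import Relation.Binary.Definitions using (tri<; tri≈; tri>)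
open import Relation.Binary.PropositionalEquality as ≡ using (_≡_; _≢_; refl; sym; trans; cong; cong₂; subst; subst₂; _≗_; module ≡-Reasoning)
open import Relation.Nullary using (¬_; Dec; does; yes; no; ¬?; contradiction; _×-dec_)
open import Relation.Nullary.Decidable using (dec-true)
open import Relation.Unary using (Pred; Decidable; _⊆_)

-- Counting in lists and natural-number arithmetic.

length-filter-disjoint : ∀ {A : Set} {P Q R : Pred A 0ℓ} (P? : Decidable P) (Q? : Decidable Q)
  (R? : Decidable R) → P ⊆ R → Q ⊆ R → (∀ {x} → P x → ¬ Q x) →
  ∀ xs → length (filter P? xs) ℕ.+ length (filter Q? xs) ℕ.≤ length (filter R? xs)
length-filter-disjoint P? Q? R? P⊆R Q⊆R P⇒¬Q [] = z≤n
length-filter-disjoint P? Q? R? P⊆R Q⊆R P⇒¬Q (x ∷ xs)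
  with ih ← length-filter-disjoint P? Q? R? P⊆R Q⊆R P⇒¬Q xs | P? x | Q? x | R? x
... | yes p | yes q | _     = contradiction q (P⇒¬Q p)
... | yes p | no _  | yes _ = s≤s ih
... | yes p | no _  | no ¬r = contradiction (P⊆R p) ¬r
... | no _  | yes q | yes _ = ℕ.≤-trans (ℕ.≤-reflexive (ℕ.+-suc _ _)) (s≤s ih)
... | no _  | yes q | no ¬r = contradiction (Q⊆R q) ¬r
... | no _  | no _  | yes _ = ℕ.m≤n⇒m≤1+n ih
... | no _  | no _  | no _  = ih

lookup-injective : ∀ {A : Set} {xs : List A} → Unique xs → Injective _≡_ _≡_ (lookup xs)
lookup-injective (_ ∷ _)    {zero}  {zero}  _  = refl
lookup-injective (x∉ ∷ _)   {zero}  {suc j} eq = contradiction eq (All.lookup x∉ (∈-lookup j))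
lookup-injective (x∉ ∷ _)   {suc i} {zero}  eq = contradiction (sym eq) (All.lookup x∉ (∈-lookup i))
lookup-injective (_ ∷ uniq) {suc i} {suc j} eq = cong suc (lookup-injective uniq eq)

-- Removing `o` from `n` lowers the quotient by exactly one and still leaves at least `m`. This is
-- what keeps ranks distinct after rounding down to multiples of `o`.
m+o≤n⇒m/o<n/o : ∀ {m n} o .{{_ : NonZero o}} → m ℕ.+ o ℕ.≤ n → m ℕ./ o ℕ.< n ℕ./ o
m+o≤n⇒m/o<n/o {m} {n} o m+o≤n = begin-strict
  m ℕ./ o                ≤⟨ /-monoˡ-≤ o (ℕ.m+n≤o⇒m≤o∸n m m+o≤n) ⟩
  (n ℕ.∸ o) ℕ./ o        <⟨ ℕ.n<1+n _ ⟩
  suc ((n ℕ.∸ o) ℕ./ o)  ≡⟨ m/n≡1+[m∸n]/n (ℕ.m+n≤o⇒n≤o m m+o≤n) ⟨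
  n ℕ./ o                ∎
  where open ℕ.≤-Reasoning

^-distribʳ-* : ∀ m n k → (m ℕ.* n) ℕ.^ k ≡ m ℕ.^ k ℕ.* n ℕ.^ k
^-distribʳ-* m n zero    = refl
^-distribʳ-* m n (suc k) = trans (cong (m ℕ.* n ℕ.*_) (^-distribʳ-* m n k))
  (ℕ.[m*n]*[o*p]≡[m*o]*[n*p] m n (m ℕ.^ k) (n ℕ.^ k))

-- Existence of a rare character in a set of keys.

module Characters {K : Set} {c s : ℕ} (_[_] : K → Fin c → Fin s)
  (extensional : ∀ {x y} → (∀ i → x [ i ] ≡ y [ i ]) → x ≡ y) where

  count : Fin c → Fin s → List K → ℕ
  count i α xs = length (filter (λ x → x [ i ] ≟ α) xs)

  -- The rank of `α`: when the keys are sorted by position `i`, the block of keys with character `α`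
  -- starts here and has length `count i α xs`.
  below : Fin c → Fin s → List K → ℕ
  below i α xs = length (filter (λ x → x [ i ] <? α) xs)

  -- The optional key q is the one whose hash value is conditioned on.
  Free : Maybe K → Fin c → Pred (Fin s) _
  Free q i α = Maybe.All (λ k → k [ i ] ≢ α) q

  free? : ∀ q i → Decidable (Free q i)
  free? q i α = Maybe.dec (λ k → ¬? (k [ i ] ≟ α)) q

  -- The only character of position `i` that is not free is the one of the conditioned key. Hence
  -- all non-free characters of a position can share one code.
  ¬free-unique : ∀ q {i α β} → ¬ Free q i α → ¬ Free q i β → α ≡ β
  ¬free-unique nothing  ¬α ¬β = contradiction nothing ¬α
  ¬free-unique (just k) {i} {α} {β} ¬α ¬β with k [ i ] ≟ α | k [ i ] ≟ β
  ... | yes refl | yes refl = refl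
  ... | no  ≢α   | _        = contradiction (just ≢α) ¬α
  ... | _        | no  ≢β   = contradiction (just ≢β) ¬β

  -- The number of conditioned keys, 0 or 1. It is also the number of extra codes per position, and
  -- `suc ∣ q ∣?` is the constant factor 1 or 2 of the final bounds.
  ∣_∣? : Maybe K → ℕ
  ∣_∣? = maybe (λ _ → 1) 0

  ¬free⇒∣q∣>0 : ∀ q {i α} → ¬ Free q i α → 0 ℕ.< ∣ q ∣?
  ¬free⇒∣q∣>0 nothing  ¬α = contradiction nothing ¬α
  ¬free⇒∣q∣>0 (just k) ¬α = s≤s z≤n

  -- A key other than `q` differs from it in some position, because characters determine keys.
  -- Without `q` any position works, and one exists because `c` is nonzero.
  ∃-free : .{{NonZero c}} → ∀ q {x} → Maybe.All (_≢ x) q → ∃ λ i → Free q i (x [ i ])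
  ∃-free {{nz}} nothing _ = first nz , nothing
    where first : ∀ {c} → .(NonZero c) → Fin c
          first {suc c} _ = zero
  ∃-free (just k) {x} (just k≢x)
    with i , ≢ ← ¬∀⟶∃¬ c _ (λ i → k [ i ] ≟ x [ i ]) (k≢x ∘ extensional) = i , just ≢

  below+count≤length : ∀ i α xs → below i α xs ℕ.+ count i α xs ℕ.≤ length xs
  below+count≤length i α xs = ℕ.≤-trans
    (length-filter-disjoint (λ x → x [ i ] <? α) (λ x → x [ i ] ≟ α) (λ x → x [ i ] ≤? α)
      ℕ.<⇒≤ Fin.≤-reflexive Fin.<⇒≢ xs)
    (length-filter (λ x → x [ i ] ≤? α) xs)

  below+count≤below : ∀ i {α β} → α Fin.< β → ∀ xs → below i α xs ℕ.+ count i α xs ℕ.≤ below i β xs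
  below+count≤below i {α} {β} α<β = length-filter-disjoint
    (λ x → x [ i ] <? α) (λ x → x [ i ] ≟ α) (λ x → x [ i ] <? β)
    (λ <α → Fin.<-trans <α α<β) (λ { refl → α<β }) Fin.<⇒≢

  module _ (q : Maybe K) {xs : List K} (uniq : Unique xs) (g : ℕ) .{{_ : NonZero g}}
    (g≤count : ∀ {x i} → x ∈ xs → Free q i (x [ i ]) → g ℕ.≤ count i (x [ i ]) xs) where

    private m = length xs

    -- Rounding the rank of a character among all characters of xs in position i down to a
    -- multiple of g is injective, since consecutive free characters are at least g ranks apart.
    code : Fin c → Fin s → ℕ
    code i α with free? q i α
    ... | yes _ = below i α xs ℕ./ g
    ... | no  _ = m ℕ./ g

    private
      free-code< : ∀ {x i} → x ∈ xs → Free q i (x [ i ]) → below i (x [ i ]) xs ℕ./ g ℕ.< m ℕ./ g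
      free-code< x∈xs free = m+o≤n⇒m/o<n/o g
        (ℕ.≤-trans (ℕ.+-monoʳ-≤ _ (g≤count x∈xs free)) (below+count≤length _ _ xs))

      free-code-mono : ∀ {x i β} → x ∈ xs → Free q i (x [ i ]) → x [ i ] Fin.< β →
        below i (x [ i ]) xs ℕ./ g ℕ.< below i β xs ℕ./ g
      free-code-mono x∈xs free <β = m+o≤n⇒m/o<n/o g
        (ℕ.≤-trans (ℕ.+-monoʳ-≤ _ (g≤count x∈xs free)) (below+count≤below _ <β xs))

    -- Free characters have codes below `m / g`, since their block of at least `g` keys ends by rank
    -- `m`. The value `m / g` itself is reserved for the non-free character; it is in range because
    -- a non-free character forces `∣ q ∣?` to be 1.
    code< : ∀ {x} i → x ∈ xs → code i (x [ i ]) ℕ.< m ℕ./ g ℕ.+ ∣ q ∣?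
    code< {x} i x∈xs with free? q i (x [ i ])
    ... | yes free = ℕ.<-≤-trans (free-code< x∈xs free) (ℕ.m≤m+n _ _)
    ... | no ¬free = ℕ.m<m+n _ (¬free⇒∣q∣>0 q ¬free)

    code-injective : ∀ {x y} i → x ∈ xs → y ∈ xs → code i (x [ i ]) ≡ code i (y [ i ]) → x [ i ] ≡ y [ i ]
    code-injective {x} {y} i x∈ y∈ eq with free? q i (x [ i ]) | free? q i (y [ i ])
    ... | yes f | no _  = contradiction eq (ℕ.<⇒≢ (free-code< x∈ f))
    ... | no _  | yes f = contradiction (sym eq) (ℕ.<⇒≢ (free-code< y∈ f))
    ... | no ¬f | no ¬g = ¬free-unique q ¬f ¬g
    ... | yes f | yes g with Fin.<-cmp (x [ i ]) (y [ i ])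
    ...   | tri< < _ _ = contradiction eq (ℕ.<⇒≢ (free-code-mono x∈ f <))
    ...   | tri≈ _ ≡ _ = ≡
    ...   | tri> _ _ > = contradiction (sym eq) (ℕ.<⇒≢ (free-code-mono y∈ g >))

    -- Coding each character separately is injective on `xs`, so the keys embed into words of length
    -- `c` over `m / g + ∣ q ∣?` digits.
    length≤#codes : m ℕ.≤ (m ℕ./ g ℕ.+ ∣ q ∣?) ℕ.^ c
    length≤#codes = injective⇒≤ {f = encode} λ {j} {k} eq → lookup-injective uniq
      (extensional λ i → code-injective i (∈-lookup j) (∈-lookup k)
        (fromℕ<-injective _ _ (code< i (∈-lookup j)) (code< i (∈-lookup k))
          (trans (sym (finToFun-funToFin (digit j) i))
            (trans (cong (λ z → finToFun z i) eq) (finToFun-funToFin (digit k) i)))))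
      where
      digit : Fin m → Fin c → Fin (m ℕ./ g ℕ.+ ∣ q ∣?)
      digit j i = fromℕ< (code< i (∈-lookup {xs = xs} j))
      encode : Fin m → Fin ((m ℕ./ g ℕ.+ ∣ q ∣?) ℕ.^ c)
      encode j = funToFin (digit j)

  -- Take the free occurrence whose character has the smallest count `g`. Every free character of
  -- `xs` then occurs at least `g` times, so the code count gives `m ≤ (m / g + ∣ q ∣?) ^ c`.
  -- Multiplying by `g ^ c` and cancelling one `m` bounds `g`. The bound reads
  -- `g ≤ suc ∣ q ∣? · m^(1-1/c)` with the root cleared.
  ∃-rare : .{{NonZero c}} → ∀ q {xs} → Unique xs → (∀ {x} → x ∈ xs → Maybe.All (_≢ x) q) → 
    .{{NonZero (length xs)}} → ∃₂ λ x i → x ∈ xs × Free q i (x [ i ]) ×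
    count i (x [ i ]) xs ℕ.^ c ℕ.≤ suc ∣ q ∣? ℕ.^ c ℕ.* length xs ℕ.^ ℕ.pred c
  ∃-rare q {xs@(x₀ ∷ _)} uniq q∉xs = x , i , x∈xs , free , bound
    where
    m = length xs

    Candidate : Pred (K × Fin c) _
    Candidate (x , i) = x ∈ xs × Free q i (x [ i ])

    size : K × Fin c → ℕ
    size (x , i) = count i (x [ i ]) xs

    isFree? : Decidable λ ((x , i) : K × Fin c) → Free q i (x [ i ])
    isFree? (x , i) = free? q i (x [ i ])

    candidates : List (K × Fin c)
    candidates = filter isFree? (cartesianProduct xs (allFin c))

    -- The minimum needs a starting value. This one is itself a candidate, so the minimiser is a
    -- candidate in every case.
    default : K × Fin c
    default = x₀ , proj₁ (∃-free q (q∉xs (here refl)))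

    best : K × Fin c
    best = argmin size default candidates

    x = proj₁ best
    i = proj₂ best
    g = size best

    candidate : Candidate best
    candidate = argmin-all size (here refl , proj₂ (∃-free q (q∉xs (here refl))))
      (All.tabulate λ xi∈ → let xi∈p , f = ∈-filter⁻ isFree? {xs = cartesianProduct xs (allFin c)} xi∈
        in proj₁ (∈-cartesianProduct⁻ xs (allFin c) xi∈p) , f)

    x∈xs = proj₁ candidate
    free = proj₂ candidate

    best-minimal : ∀ {x i} → x ∈ xs → Free q i (x [ i ]) → g ℕ.≤ count i (x [ i ]) xs
    best-minimal x∈ f = All.lookup (f[argmin]≤f[xs] default candidates)
      (∈-filter⁺ isFree? (∈-cartesianProduct⁺ x∈ (∈-allFin _)) f)

    instance
      g≢0 : NonZero g
      g≢0 = >-nonZero (filter-some (λ y → y [ i ] ≟ x [ i ]) (Any.map (λ { refl → refl }) x∈xs))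

    bound : g ℕ.^ c ℕ.≤ suc ∣ q ∣? ℕ.^ c ℕ.* m ℕ.^ ℕ.pred c
    bound = ℕ.*-cancelʳ-≤ _ _ m (begin
      g ℕ.^ c ℕ.* m                                ≤⟨ ℕ.*-monoʳ-≤ (g ℕ.^ c) (length≤#codes q uniq g best-minimal) ⟩
      g ℕ.^ c ℕ.* (m ℕ./ g ℕ.+ ∣ q ∣?) ℕ.^ c       ≡⟨ ^-distribʳ-* g _ c ⟨
      (g ℕ.* (m ℕ./ g ℕ.+ ∣ q ∣?)) ℕ.^ c           ≤⟨ ℕ.^-monoˡ-≤ c (begin
        g ℕ.* (m ℕ./ g ℕ.+ ∣ q ∣?)                 ≡⟨ ℕ.*-comm g _ ⟩
        (m ℕ./ g ℕ.+ ∣ q ∣?) ℕ.* g                 ≡⟨ ℕ.*-distribʳ-+ g (m ℕ./ g) ∣ q ∣? ⟩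
        -- Rounding loses nothing in this direction, and `g ≤ m` because `g` counts a sublist of
        -- `xs`.
        m ℕ./ g ℕ.* g ℕ.+ ∣ q ∣? ℕ.* g             ≤⟨ ℕ.+-mono-≤ (m/n*n≤m m g)
                                                        (ℕ.*-monoʳ-≤ ∣ q ∣? (length-filter (λ y → y [ i ] ≟ x [ i ]) xs)) ⟩
        suc ∣ q ∣? ℕ.* m                           ∎) ⟩
      (suc ∣ q ∣? ℕ.* m) ℕ.^ c                     ≡⟨ ^-distribʳ-* (suc ∣ q ∣?) m c ⟩
      suc ∣ q ∣? ℕ.^ c ℕ.* m ℕ.^ c                 ≡⟨ cong (λ k → suc ∣ q ∣? ℕ.^ c ℕ.* m ℕ.^ k) (ℕ.suc-pred c) ⟨
      suc ∣ q ∣? ℕ.^ c ℕ.* (m ℕ.* m ℕ.^ ℕ.pred c)  ≡⟨ cong (suc ∣ q ∣? ℕ.^ c ℕ.*_) (ℕ.*-comm m _) ⟩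
      suc ∣ q ∣? ℕ.^ c ℕ.* (m ℕ.^ ℕ.pred c ℕ.* m)  ≡⟨ ℕ.*-assoc (suc ∣ q ∣? ℕ.^ c) _ m ⟨
      suc ∣ q ∣? ℕ.^ c ℕ.* m ℕ.^ ℕ.pred c ℕ.* m    ∎)
      where open ℕ.≤-Reasoning

-- Rational arithmetic and finite sums.

private
  module ℚ-ring = CommutativeRing +-*-commutativeRing

∑ : ∀ {N} → (Fin N → ℚ) → ℚ
∑ = sum +-0-rawMonoid

*-monoˡ-≤ : ∀ {r p q} → 0ℚ ≤ r → p ≤ q → r * p ≤ r * q
*-monoˡ-≤ {r} 0≤r = ℚ.*-monoˡ-≤-nonNeg r {{nonNegative 0≤r}}

*-monoʳ-≤ : ∀ {r p q} → 0ℚ ≤ r → p ≤ q → p * r ≤ q * r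
*-monoʳ-≤ {r} 0≤r = ℚ.*-monoʳ-≤-nonNeg r {{nonNegative 0≤r}}

0≤p*q : ∀ {p q} → 0ℚ ≤ p → 0ℚ ≤ q → 0ℚ ≤ p * q
0≤p*q {p} {q} 0≤p 0≤q = subst (_≤ p * q) (ℚ.*-zeroʳ p) (*-monoˡ-≤ 0≤p 0≤q)

p≤q⇒0≤q-p : ∀ {p q} → p ≤ q → 0ℚ ≤ q - p
p≤q⇒0≤q-p {p} {q} p≤q = subst (_≤ q - p) (ℚ.+-inverseʳ p) (ℚ.+-monoˡ-≤ (- p) p≤q)

0≤q-p⇒p≤q : ∀ {p q} → 0ℚ ≤ q - p → p ≤ q
0≤q-p⇒p≤q {p} {q} 0≤q-p = subst₂ _≤_ (ℚ.+-identityˡ p)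
  (solve 2 (λ p q → q :- p :+ p := q) refl p q) (ℚ.+-monoˡ-≤ p 0≤q-p)
  where open +-*-Solver

∣p∣≤q : ∀ {p q} → p ≤ q → - p ≤ q → abs p ≤ q
∣p∣≤q {p} p≤q -p≤q with ℚ.∣p∣≡p∨∣p∣≡-p p
... | inj₁ eq = subst (_≤ _) (sym eq) p≤q
... | inj₂ eq = subst (_≤ _) (sym eq) -p≤q

0≤^ℚ : ∀ {p} k → 0ℚ ≤ p → 0ℚ ≤ p ^ℚ k
0≤^ℚ zero    0≤p = ℚ.nonNegative⁻¹ 1ℚ
0≤^ℚ (suc k) 0≤p = 0≤p*q 0≤p (0≤^ℚ k 0≤p)

^ℚ-mono-≤ : ∀ {p q} k → 0ℚ ≤ p → p ≤ q → p ^ℚ k ≤ q ^ℚ k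
^ℚ-mono-≤ zero    0≤p p≤q = ℚ.≤-refl
^ℚ-mono-≤ (suc k) 0≤p p≤q = ℚ.≤-trans (*-monoʳ-≤ (0≤^ℚ k 0≤p) p≤q)
  (*-monoˡ-≤ (ℚ.≤-trans 0≤p p≤q) (^ℚ-mono-≤ k 0≤p p≤q))

^ℚ-distrib-* : ∀ p q k → (p * q) ^ℚ k ≡ p ^ℚ k * q ^ℚ k
^ℚ-distrib-* = semiring-^-distrib-* ℚ-ring.commutativeSemiring

toℚᵘ-fromℕ : ∀ k → toℚᵘ (fromℕ k) ℚᵘ.≃ mkℚᵘ (+ k) 0
toℚᵘ-fromℕ k = ℚ.toℚᵘ-fromℚᵘ (mkℚᵘ (+ k) 0)

fromℕ-+ : ∀ j k → fromℕ (j ℕ.+ k) ≡ fromℕ j + fromℕ k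
fromℕ-+ j k = ℚ.toℚᵘ-injective (begin
  toℚᵘ (fromℕ (j ℕ.+ k))                ≈⟨ toℚᵘ-fromℕ (j ℕ.+ k) ⟩
  mkℚᵘ (+ (j ℕ.+ k)) 0                  ≈⟨ *≡* (cong (ℤ._* + 1) (sym (cong₂ ℤ._+_ (ℤ.*-identityʳ (+ j)) (ℤ.*-identityʳ (+ k))))) ⟩
  mkℚᵘ (+ j) 0 ℚᵘ.+ mkℚᵘ (+ k) 0        ≈⟨ ℚᵘ.+-cong (toℚᵘ-fromℕ j) (toℚᵘ-fromℕ k) ⟨
  toℚᵘ (fromℕ j) ℚᵘ.+ toℚᵘ (fromℕ k)    ≈⟨ ℚ.toℚᵘ-homo-+ (fromℕ j) (fromℕ k) ⟨
  toℚᵘ (fromℕ j + fromℕ k)              ∎)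
  where open ℚᵘ.≃-Reasoning

fromℕ-* : ∀ j k → fromℕ (j ℕ.* k) ≡ fromℕ j * fromℕ k
fromℕ-* j k = ℚ.toℚᵘ-injective (begin
  toℚᵘ (fromℕ (j ℕ.* k))                ≈⟨ toℚᵘ-fromℕ (j ℕ.* k) ⟩
  mkℚᵘ (+ (j ℕ.* k)) 0                  ≈⟨ *≡* (cong (ℤ._* + 1) (ℤ.pos-* j k)) ⟩
  mkℚᵘ (+ j) 0 ℚᵘ.* mkℚᵘ (+ k) 0        ≈⟨ ℚᵘ.*-cong (toℚᵘ-fromℕ j) (toℚᵘ-fromℕ k) ⟨
  toℚᵘ (fromℕ j) ℚᵘ.* toℚᵘ (fromℕ k)    ≈⟨ ℚ.toℚᵘ-homo-* (fromℕ j) (fromℕ k) ⟨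
  toℚᵘ (fromℕ j * fromℕ k)              ∎)
  where open ℚᵘ.≃-Reasoning

fromℕ-^ : ∀ j k → fromℕ (j ℕ.^ k) ≡ fromℕ j ^ℚ k
fromℕ-^ j zero    = refl
fromℕ-^ j (suc k) = trans (fromℕ-* j (j ℕ.^ k)) (cong (fromℕ j *_) (fromℕ-^ j k))

fromℕ-mono-≤ : ∀ {j k} → j ℕ.≤ k → fromℕ j ≤ fromℕ k
fromℕ-mono-≤ {j} {k} j≤k = ℚ.toℚᵘ-cancel-≤ (begin
  toℚᵘ (fromℕ j)    ≃⟨ toℚᵘ-fromℕ j ⟩
  mkℚᵘ (+ j) 0      ≤⟨ *≤* (ℤ.*-monoʳ-≤-nonNeg (+ 1) (ℤ.+≤+ j≤k)) ⟩
  mkℚᵘ (+ k) 0      ≃⟨ toℚᵘ-fromℕ k ⟨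
  toℚᵘ (fromℕ k)    ∎)
  where open ℚᵘ.≤-Reasoning

0≤fromℕ : ∀ k → 0ℚ ≤ fromℕ k
0≤fromℕ k = fromℕ-mono-≤ {0} {k} ℕ.z≤n

n*1/n≡1 : ∀ n .{{_ : NonZero n}} → fromℕ n * (+ 1 / n) ≡ 1ℚ
n*1/n≡1 n@(suc n-1) = ℚ.toℚᵘ-injective (begin
  toℚᵘ (fromℕ n * (+ 1 / n))              ≈⟨ ℚ.toℚᵘ-homo-* (fromℕ n) (+ 1 / n) ⟩
  toℚᵘ (fromℕ n) ℚᵘ.* toℚᵘ (+ 1 / n)      ≈⟨ ℚᵘ.*-cong (toℚᵘ-fromℕ n) (ℚ.toℚᵘ-fromℚᵘ (mkℚᵘ (+ 1) n-1)) ⟩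
  mkℚᵘ (+ n) 0 ℚᵘ.* mkℚᵘ (+ 1) n-1        ≈⟨ *≡* (trans (ℤ.*-identityʳ _) (trans (ℤ.*-identityʳ _) (sym (trans (ℤ.*-identityˡ _) (cong (λ k → + suc k) (ℕ.+-identityʳ n-1)))))) ⟩
  toℚᵘ 1ℚ                                 ∎)
  where open ℚᵘ.≃-Reasoning

0≤1/n : ∀ n .{{_ : NonZero n}} → 0ℚ ≤ + 1 / n
0≤1/n (suc n-1) = ℚ.nonNegative⁻¹ _ {{ℚ.normalize-nonNeg 1 (suc n-1)}}

1/n≤1 : ∀ n .{{_ : NonZero n}} → + 1 / n ≤ 1ℚ
1/n≤1 n = subst₂ _≤_ (ℚ.*-identityˡ _) (n*1/n≡1 n)
  (*-monoʳ-≤ (0≤1/n n) (fromℕ-mono-≤ (ℕ.>-nonZero⁻¹ n)))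

neg-as-* : ∀ p → - p ≡ (- 1ℚ) * p
neg-as-* p = trans (cong -_ (sym (ℚ.*-identityˡ p))) (ℚ.neg-distribˡ-* 1ℚ p)

∑-cong : ∀ {N} {f g : Fin N → ℚ} → f ≗ g → ∑ f ≡ ∑ g
∑-cong = sum-cong-≗ ℚ.+-0-monoid

∑-mono : ∀ {N} {f g : Fin N → ℚ} → (∀ i → f i ≤ g i) → ∑ f ≤ ∑ g
∑-mono {zero}  f≤g = ℚ.≤-refl
∑-mono {suc N} f≤g = ℚ.+-mono-≤ (f≤g zero) (∑-mono (λ i → f≤g (suc i)))

∣∑∣≤∑∣∣ : ∀ {N} (f : Fin N → ℚ) → abs (∑ f) ≤ ∑ (λ i → abs (f i))
∣∑∣≤∑∣∣ {zero}  f = ℚ.≤-refl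
∣∑∣≤∑∣∣ {suc N} f = ℚ.≤-trans (ℚ.∣p+q∣≤∣p∣+∣q∣ (f zero) _) (ℚ.+-monoʳ-≤ (abs (f zero)) (∣∑∣≤∑∣∣ (λ i → f (suc i))))

∑-+ : ∀ {N} (f g : Fin N → ℚ) → ∑ (λ i → f i + g i) ≡ ∑ f + ∑ g
∑-+ = ∑-distrib-+ +-0-commutativeMonoid

∑-* : ∀ {N} p (f : Fin N → ℚ) → p * ∑ f ≡ ∑ (λ i → p * f i)
∑-* = *-distribˡ-sum ℚ-ring.semiring

∑-const : ∀ N p → ∑ {N} (λ _ → p) ≡ fromℕ N * p
∑-const zero    p = sym (ℚ.*-zeroˡ p)
∑-const (suc N) p = begin
  p + ∑ {N} (λ _ → p)       ≡⟨ cong₂ _+_ (sym (ℚ.*-identityˡ p)) (∑-const N p) ⟩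
  fromℕ 1 * p + fromℕ N * p ≡⟨ ℚ.*-distribʳ-+ p (fromℕ 1) (fromℕ N) ⟨
  (fromℕ 1 + fromℕ N) * p   ≡⟨ cong (_* p) (fromℕ-+ 1 N) ⟨
  fromℕ (suc N) * p         ∎
  where open ≡-Reasoning

-- Indicators and expectations under the uniform distribution.

𝟙 : {A : Set} → Dec A → ℚ
𝟙 A? = if does A? then 1ℚ else 0ℚ

0≤𝟙 : {A : Set} (A? : Dec A) → 0ℚ ≤ 𝟙 A?
0≤𝟙 (yes _) = ℚ.nonNegative⁻¹ 1ℚ
0≤𝟙 (no _)  = ℚ.≤-refl

𝟙≤1 : {A : Set} (A? : Dec A) → 𝟙 A? ≤ 1ℚ
𝟙≤1 (yes _) = ℚ.≤-refl
𝟙≤1 (no _)  = ℚ.nonNegative⁻¹ 1ℚ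

𝟙-cong : {A B : Set} (A? : Dec A) (B? : Dec B) → (A → B) → (B → A) → 𝟙 A? ≡ 𝟙 B?
𝟙-cong (yes _) (yes _) _ _ = refl
𝟙-cong (yes a) (no ¬b) f _ with () ← ¬b (f a)
𝟙-cong (no ¬a) (yes b) _ g with () ← ¬a (g b)
𝟙-cong (no _)  (no _)  _ _ = refl

module _ {N : ℕ} .{{_ : NonZero N}} where

  𝔼-cong : {f g : Fin N → ℚ} → f ≗ g → 𝔼 f ≡ 𝔼 g
  𝔼-cong f≗g = cong (_* (+ 1 / N)) (∑-cong f≗g)

  𝔼-+ : ∀ (f g : Fin N → ℚ) → 𝔼 (λ ω → f ω + g ω) ≡ 𝔼 f + 𝔼 g
  𝔼-+ f g = trans (cong (_* (+ 1 / N)) (∑-distrib-+ +-0-commutativeMonoid f g)) (ℚ.*-distribʳ-+ (+ 1 / N) (∑ f) (∑ g))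

  𝔼-* : ∀ p (f : Fin N → ℚ) → 𝔼 (λ ω → p * f ω) ≡ p * 𝔼 f
  𝔼-* p f = trans (cong (_* (+ 1 / N)) (sym (*-distribˡ-sum ℚ-ring.semiring p f))) (ℚ.*-assoc p (∑ f) (+ 1 / N))

  𝔼-− : ∀ (f g : Fin N → ℚ) → 𝔼 (λ ω → f ω - g ω) ≡ 𝔼 f - 𝔼 g
  𝔼-− f g = begin
    𝔼 (λ ω → f ω - g ω)               ≡⟨ 𝔼-cong (λ ω → cong (_+_ (f ω)) (neg-as-* (g ω))) ⟩
    𝔼 (λ ω → f ω + (- 1ℚ) * g ω)      ≡⟨ 𝔼-+ f (λ ω → (- 1ℚ) * g ω) ⟩
    𝔼 f + 𝔼 (λ ω → (- 1ℚ) * g ω)      ≡⟨ cong (_+_ (𝔼 f)) (trans (𝔼-* (- 1ℚ) g) (sym (neg-as-* (𝔼 g)))) ⟩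
    𝔼 f - 𝔼 g                         ∎
    where open ≡-Reasoning

  𝔼-mono : {f g : Fin N → ℚ} → (∀ ω → f ω ≤ g ω) → 𝔼 f ≤ 𝔼 g
  𝔼-mono f≤g = *-monoʳ-≤ (0≤1/n N) (∑-mono f≤g)

  𝔼-const : ∀ p → 𝔼 {N} (λ _ → p) ≡ p
  𝔼-const p = begin
    ∑ {N} (λ _ → p) * (+ 1 / N)  ≡⟨ cong (_* (+ 1 / N)) (∑-const N p) ⟩
    fromℕ N * p * (+ 1 / N)      ≡⟨ solve 3 (λ n p ν → n :* p :* ν := n :* ν :* p) refl (fromℕ N) p (+ 1 / N) ⟩
    fromℕ N * (+ 1 / N) * p      ≡⟨ cong (_* p) (n*1/n≡1 N) ⟩
    1ℚ * p                       ≡⟨ ℚ.*-identityˡ p ⟩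
    p                            ∎
    where
    open ≡-Reasoning
    open +-*-Solver

  0≤𝔼 : {f : Fin N → ℚ} → (∀ ω → 0ℚ ≤ f ω) → 0ℚ ≤ 𝔼 f
  0≤𝔼 {f} 0≤f = subst (_≤ 𝔼 f) (𝔼-const 0ℚ) (𝔼-mono 0≤f)

  𝔼-∑ : ∀ {n} (f : Fin N → Fin n → ℚ) → 𝔼 (λ ω → ∑ (f ω)) ≡ ∑ (λ y → 𝔼 (λ ω → f ω y))
  𝔼-∑ f = trans (cong (_* (+ 1 / N)) (∑-comm +-0-commutativeMonoid f)) (*-distribʳ-sum ℚ-ring.semiring (+ 1 / N) (λ y → ∑ (λ ω → f ω y)))

  -- All independence statements about the tables reduce to this: a bijection of the sample space
  -- preserves the uniform distribution.
  𝔼-permute : ∀ (π : Permutation′ N) (f : Fin N → ℚ) → 𝔼 (λ ω → f (π ⟨$⟩ʳ ω)) ≡ 𝔼 f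
  𝔼-permute π f = cong (_* (+ 1 / N)) (sym (sum-permute +-0-commutativeMonoid f π))

-- Subsets as lists, and images.

elements : ∀ {u} → Subset u → List (Fin u)
elements []            = []
elements (outside ∷ p) = map suc (elements p)
elements (inside  ∷ p) = zero ∷ map suc (elements p)

length-elements : ∀ {u} (p : Subset u) → length (elements p) ≡ ∣ p ∣
length-elements []            = refl
length-elements (outside ∷ p) = trans (length-map suc (elements p)) (length-elements p)
length-elements (inside  ∷ p) = cong suc (trans (length-map suc (elements p)) (length-elements p))

elements-unique : ∀ {u} (p : Subset u) → Unique (elements p)
elements-unique []            = []
elements-unique (outside ∷ p) = Unique.map⁺ suc-injective (elements-unique p)
elements-unique (inside  ∷ p) = All.map⁺ (All.universal (λ _ ()) (elements p)) ∷ Unique.map⁺ suc-injective (elements-unique p)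

∈-elements⁺ : ∀ {u x} {p : Subset u} → x ∈ˢ p → x ∈ elements p
∈-elements⁺ {p = inside  ∷ p} here        = here refl
∈-elements⁺ {p = inside  ∷ p} (there x∈p) = there (∈-map⁺ suc (∈-elements⁺ x∈p))
∈-elements⁺ {p = outside ∷ p} (there x∈p) = ∈-map⁺ suc (∈-elements⁺ x∈p)

∈-elements⁻ : ∀ {u x} (p : Subset u) → x ∈ elements p → x ∈ˢ p
∈-elements⁻ (outside ∷ p) x∈         with _ , y∈ , refl ← ∈-map⁻ suc x∈ = there (∈-elements⁻ p y∈)
∈-elements⁻ (inside  ∷ p) (here refl) = here
∈-elements⁻ (inside  ∷ p) (there x∈) with _ , y∈ , refl ← ∈-map⁻ suc x∈ = there (∈-elements⁻ p y∈)

∑-∈ : ∀ {u} (p : Subset u) → ∑ (λ y → 𝟙 (y ∈? p)) ≡ fromℕ ∣ p ∣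
∑-∈ []      = refl
∑-∈ (b ∷ p) = trans (cong (_+_ (𝟙 (zero ∈? (b ∷ p)))) (trans (∑-cong shifted) (∑-∈ p))) (first b)
  where
  shifted : ∀ y → 𝟙 (suc y ∈? (b ∷ p)) ≡ 𝟙 (y ∈? p)
  shifted y = 𝟙-cong (suc y ∈? (b ∷ p)) (y ∈? p) drop-there there
  first : ∀ b → 𝟙 (zero ∈? (b ∷ p)) + fromℕ ∣ p ∣ ≡ fromℕ ∣ b ∷ p ∣
  first outside = ℚ.+-identityˡ (fromℕ ∣ p ∣)
  first inside  = sym (fromℕ-+ 1 ∣ p ∣)

∈-image⁺ : ∀ {u n} (f : Fin u → Fin n) X {x y} → x ∈ˢ X → f x ≡ y → y ∈ˢ image f X
∈-image⁺ f X {x} {y} x∈X fx≡y = lookup⇒[]= y (image f X) (trans (lookup∘tabulate _ y)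
  (dec-true (any? λ x → (x ∈? X) ×-dec (f x ≟ y)) (x , x∈X , fx≡y)))

∈-image⁻ : ∀ {u n} (f : Fin u → Fin n) X {y} → y ∈ˢ image f X → ∃ λ x → x ∈ˢ X × f x ≡ y
∈-image⁻ f X {y} y∈ = witness (any? λ x → (x ∈? X) ×-dec (f x ≟ y)) (trans (sym (lookup∘tabulate _ y)) ([]=⇒lookup y∈))
  where
  witness : {A : Set} (A? : Dec A) → does A? ≡ true → A
  witness (yes a) _ = a

-- Conditional probability.

𝟙-× : {A B : Set} (A? : Dec A) (B? : Dec B) → 𝟙 (A? ×-dec B?) ≡ 𝟙 B? * 𝟙 A?
𝟙-× (yes _) (yes _) = refl
𝟙-× (yes _) (no _)  = refl
𝟙-× (no _)  (yes _) = refl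
𝟙-× (no _)  (no _)  = refl

module _ {N : ℕ} .{{_ : NonZero N}} where

  -- Clears the denominator, so that conditioning becomes an unconditional expectation weighted by
  -- the indicator of `B`. Positivity of `Pr B?` excludes the dummy value.
  Pr[∣]*Pr : {A B : Pred (Fin N) 0ℓ} (A? : Decidable A) (B? : Decidable B) → Pr B? ≢ 0ℚ →
    Pr[ A? ∣ B? ] * Pr B? ≡ Pr (λ ω → A? ω ×-dec B? ω)
  Pr[∣]*Pr A? B? B≢0 with Pr B? ℚ.≟ 0ℚ
  ... | yes B≡0 = contradiction B≡0 B≢0
  ... | no  B≢0 = trans (ℚ.*-assoc a (1/ Pr B?) (Pr B?)) (trans (cong (a *_) (ℚ.*-inverseˡ (Pr B?))) (ℚ.*-identityʳ a))
    where
    instance _ = ℚ.≢-nonZero B≢0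
    a = Pr (λ ω → A? ω ×-dec B? ω)

-- The goal unfolds to `t ^ c ≤ m ^ (2c - 1)` for nonnegative `t`. Raising the second hypothesis to
-- the power `c` gives `t ^ c · κ ^ c ≤ m ^ c · D ^ c ≤ m ^ c · κ ^ c · m ^ (c - 1)`, and `κ ^ c`
-- cancels.
root-bound : ∀ c κ m D {t} .{{_ : NonZero c}} .{{_ : NonZero κ}} →
  D ℕ.^ c ℕ.≤ κ ℕ.^ c ℕ.* m ℕ.^ ℕ.pred c → t * fromℕ κ ≤ fromℕ (m ℕ.* D) →
  t ≤ʳ m ^⟨ (2 ℕ.* c ℕ.∸ 1) / c ⟩
root-bound c κ m D {t} D-bound tκ≤mD 0≤t = ℚ.*-cancelʳ-≤-pos (fromℕ (κ ℕ.^ c)) {{κᶜ-positive}} (begin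
  t ^ℚ c * fromℕ (κ ℕ.^ c)                   ≡⟨ cong (t ^ℚ c *_) (fromℕ-^ κ c) ⟩
  t ^ℚ c * fromℕ κ ^ℚ c                      ≡⟨ ^ℚ-distrib-* t (fromℕ κ) c ⟨
  (t * fromℕ κ) ^ℚ c                         ≤⟨ ^ℚ-mono-≤ c (0≤p*q 0≤t (0≤fromℕ κ)) tκ≤mD ⟩
  fromℕ (m ℕ.* D) ^ℚ c                       ≡⟨ fromℕ-^ (m ℕ.* D) c ⟨
  fromℕ ((m ℕ.* D) ℕ.^ c)                    ≤⟨ fromℕ-mono-≤ mD-bound ⟩
  fromℕ (m ℕ.^ (2 ℕ.* c ℕ.∸ 1) ℕ.* κ ℕ.^ c)  ≡⟨ fromℕ-* (m ℕ.^ (2 ℕ.* c ℕ.∸ 1)) (κ ℕ.^ c) ⟩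
  fromℕ (m ℕ.^ (2 ℕ.* c ℕ.∸ 1)) * fromℕ (κ ℕ.^ c) ∎)
  where
  open ℚ.≤-Reasoning
  κᶜ-positive : ℚ.Positive (fromℕ (κ ℕ.^ c))
  κᶜ-positive = positive (ℚ.<-≤-trans (ℚ.positive⁻¹ 1ℚ) (fromℕ-mono-≤ (ℕ.>-nonZero⁻¹ (κ ℕ.^ c) {{ℕ.m^n≢0 κ c}})))

  2c-1 : ∀ c .{{_ : NonZero c}} → c ℕ.+ ℕ.pred c ≡ 2 ℕ.* c ℕ.∸ 1
  2c-1 (suc k) = sym (trans (ℕ.+-suc k (k ℕ.+ 0)) (cong (λ l → suc (k ℕ.+ l)) (ℕ.+-identityʳ k)))

  mD-bound : (m ℕ.* D) ℕ.^ c ℕ.≤ m ℕ.^ (2 ℕ.* c ℕ.∸ 1) ℕ.* κ ℕ.^ c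
  mD-bound = ℕ.≤-trans (ℕ.≤-trans (ℕ.≤-reflexive (^-distribʳ-* m D c)) (ℕ.*-monoʳ-≤ (m ℕ.^ c) D-bound)) (ℕ.≤-reflexive
    (trans (cong (m ℕ.^ c ℕ.*_) (ℕ.*-comm (κ ℕ.^ c) (m ℕ.^ ℕ.pred c)))
    (trans (sym (ℕ.*-assoc (m ℕ.^ c) (m ℕ.^ ℕ.pred c) (κ ℕ.^ c)))
    (cong (ℕ._* κ ℕ.^ c) (trans (sym (ℕ.^-distribˡ-+-* m c (ℕ.pred c))) (cong (m ℕ.^_) (2c-1 c)))))))

-- Bitwise XOR on encoded bit strings.

funToFin-cong : ∀ {m n} {f g : Fin m → Fin n} → f ≗ g → funToFin f ≡ funToFin g
funToFin-cong {zero}  f≗g = refl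
funToFin-cong {suc m} f≗g = cong₂ combine (f≗g zero) (funToFin-cong (f≗g ∘ suc))

finToFun-injective : ∀ {m n} {a b : Fin (m ℕ.^ n)} → finToFun {m} {n} a ≗ finToFun b → a ≡ b
finToFun-injective {m} {n} {a} {b} a≗b = trans (sym (funToFin-finToFin {n} {m} a))
  (trans (funToFin-cong a≗b) (funToFin-finToFin {n} {m} b))

⊕₂-comm : ∀ a b → a ⊕₂ b ≡ b ⊕₂ a
⊕₂-comm zero       zero       = refl
⊕₂-comm zero       (suc zero) = refl
⊕₂-comm (suc zero) zero       = refl
⊕₂-comm (suc zero) (suc zero) = refl

⊕₂-assoc : ∀ a b c → (a ⊕₂ b) ⊕₂ c ≡ a ⊕₂ (b ⊕₂ c)
⊕₂-assoc zero       b          c = refl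
⊕₂-assoc (suc zero) zero       c = refl
⊕₂-assoc (suc zero) (suc zero) c = sym (Fin.opposite-involutive c)

⊕₂-cancel : ∀ a b → (a ⊕₂ b) ⊕₂ b ≡ a
⊕₂-cancel zero       zero       = refl
⊕₂-cancel zero       (suc zero) = refl
⊕₂-cancel (suc zero) zero       = refl
⊕₂-cancel (suc zero) (suc zero) = refl

module _ {r : ℕ} where

  private
    infixl 6 _⊞_
    _⊞_ : Fin (2 ℕ.^ r) → Fin (2 ℕ.^ r) → Fin (2 ℕ.^ r)
    _⊞_ = _⊕_ {r}

    bit : Fin (2 ℕ.^ r) → Fin r → Fin 2
    bit = finToFun

    bit-⊕ : ∀ a b i → bit (a ⊞ b) i ≡ bit a i ⊕₂ bit b i
    bit-⊕ a b = finToFun-funToFin (λ i → bit a i ⊕₂ bit b i)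

  ⊕-comm : ∀ a b → a ⊞ b ≡ b ⊞ a
  ⊕-comm a b = funToFin-cong {r} λ i → ⊕₂-comm (bit a i) (bit b i)

  ⊕-assoc : ∀ a b c → (a ⊞ b) ⊞ c ≡ a ⊞ (b ⊞ c)
  ⊕-assoc a b c = funToFin-cong {r} λ i → begin
    bit (a ⊞ b) i ⊕₂ bit c i             ≡⟨ cong (_⊕₂ bit c i) (bit-⊕ a b i) ⟩
    (bit a i ⊕₂ bit b i) ⊕₂ bit c i      ≡⟨ ⊕₂-assoc (bit a i) (bit b i) (bit c i) ⟩
    bit a i ⊕₂ (bit b i ⊕₂ bit c i)      ≡⟨ cong (bit a i ⊕₂_) (bit-⊕ b c i) ⟨
    bit a i ⊕₂ bit (b ⊞ c) i             ∎
    where open ≡-Reasoning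

  ⊕-cancel : ∀ a b → (a ⊞ b) ⊞ b ≡ a
  ⊕-cancel a b = finToFun-injective {2} {r} λ i → begin
    bit ((a ⊞ b) ⊞ b) i                  ≡⟨ bit-⊕ (a ⊞ b) b i ⟩
    bit (a ⊞ b) i ⊕₂ bit b i             ≡⟨ cong (_⊕₂ bit b i) (bit-⊕ a b i) ⟩
    (bit a i ⊕₂ bit b i) ⊕₂ bit b i      ≡⟨ ⊕₂-cancel (bit a i) (bit b i) ⟩
    bit a i                              ∎
    where open ≡-Reasoning

  a⊕[b⊕a]≡b : ∀ a b → a ⊞ (b ⊞ a) ≡ b
  a⊕[b⊕a]≡b a b = trans (⊕-comm a (b ⊞ a)) (⊕-cancel b a)

  -- By associativity and commutativity, a change XORed into one summand can be moved outside the
  -- whole XOR.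
  foldr-⊕-updateAt : ∀ {c} (t : Vector (Fin (2 ℕ.^ r)) c) i b →
    foldr _⊞_ (0ʳ {r}) (updateAt t i (_⊞ b)) ≡ foldr _⊞_ (0ʳ {r}) t ⊞ b
  foldr-⊕-updateAt t zero b = begin
    (t zero ⊞ b) ⊞ F      ≡⟨ ⊕-assoc (t zero) b F ⟩
    t zero ⊞ (b ⊞ F)      ≡⟨ cong (t zero ⊞_) (⊕-comm b F) ⟩
    t zero ⊞ (F ⊞ b)      ≡⟨ ⊕-assoc (t zero) F b ⟨
    (t zero ⊞ F) ⊞ b      ∎
    where open ≡-Reasoning
          F = foldr _⊞_ (0ʳ {r}) (t ∘ suc)
  foldr-⊕-updateAt t (suc i) b = trans (cong (t zero ⊞_) (foldr-⊕-updateAt (t ∘ suc) i b))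
    (sym (⊕-assoc (t zero) _ b))

-- Symmetries of the space of tables.

module SimpleTabulation (c s r : ℕ) where
  open Tabulation c s r
  open Characters {Key} {c} {s} _[_] (finToFun-injective {s} {c})

  Ω : Set
  Ω = Fin #Ω

  private
    ν ρ : ℚ
    ν = + 1 / n
    ρ = 1ℚ - ν

    0≤ν : 0ℚ ≤ ν
    0≤ν = 0≤1/n n

    ν*n≡1 : ν * fromℕ n ≡ 1ℚ
    ν*n≡1 = trans (ℚ.*-comm ν (fromℕ n)) (n*1/n≡1 n)

    rows : Ω → Fin c → Fin (n ℕ.^ s)
    rows = finToFun

    row : Fin (n ℕ.^ s) → Fin s → Bin
    row = finToFun

  -- XORs `b` into the single table entry `(i , α)`, reached through the two encoding levels of `ω`.
  -- Being an involution, it preserves the uniform distribution; it expresses that this entry is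
  -- uniform and independent of the others.
  shift : Fin c → Fin s → Bin → Ω → Ω
  shift i α b ω = funToFin (updateAt (rows ω) i λ t → funToFin (updateAt (row t) α λ v → _⊕_ {r} v b))

  table-shift : ∀ i α b ω → table (shift i α b ω) i α ≡ _⊕_ {r} (table ω i α) b
  table-shift i α b ω = begin
    row (rows (shift i α b ω) i) α                     ≡⟨ cong (λ t → row t α) (finToFun-funToFin (updateAt (rows ω) i _) i) ⟩
    row (updateAt (rows ω) i _ i) α                    ≡⟨ cong (λ t → row t α) (updateAt-updates i (rows ω)) ⟩
    row (funToFin (updateAt (table ω i) α _)) α        ≡⟨ finToFun-funToFin (updateAt (table ω i) α _) α ⟩
    updateAt (table ω i) α _ α                         ≡⟨ updateAt-updates α (table ω i) ⟩
    _⊕_ {r} (table ω i α) b                            ∎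
    where open ≡-Reasoning

  table-shift-minimal : ∀ i α b ω j β → (j ≡ i → β ≢ α) → table (shift i α b ω) j β ≡ table ω j β
  table-shift-minimal i α b ω j β ≢ with j ≟ i
  ... | no j≢i = cong (λ t → row t β) (trans (finToFun-funToFin (updateAt (rows ω) i _) j)
          (updateAt-minimal j i (rows ω) j≢i))
  ... | yes refl = begin
    row (rows (shift i α b ω) i) β                     ≡⟨ cong (λ t → row t β) (finToFun-funToFin (updateAt (rows ω) i _) i) ⟩
    row (updateAt (rows ω) i _ i) β                    ≡⟨ cong (λ t → row t β) (updateAt-updates i (rows ω)) ⟩
    row (funToFin (updateAt (table ω i) α _)) β        ≡⟨ finToFun-funToFin (updateAt (table ω i) α _) β ⟩
    updateAt (table ω i) α _ β                         ≡⟨ updateAt-minimal β α (table ω i) (≢ refl) ⟩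
    table ω i β                                        ∎
    where open ≡-Reasoning

  shift-involutive : ∀ i α b ω → shift i α b (shift i α b ω) ≡ ω
  shift-involutive i α b ω = finToFun-injective {n ℕ.^ s} {c} λ j → finToFun-injective {n} {s} λ β → entry j β
    where
    entry : ∀ j β → table (shift i α b (shift i α b ω)) j β ≡ table ω j β
    entry j β with j ≟ i | β ≟ α
    ... | yes refl | yes refl = trans (table-shift i α b (shift i α b ω))
            (trans (cong (λ v → _⊕_ {r} v b) (table-shift i α b ω)) (⊕-cancel {r} (table ω i α) b))
    ... | no j≢i   | _        = trans (table-shift-minimal i α b (shift i α b ω) j β λ j≡i → contradiction j≡i j≢i)
                                      (table-shift-minimal i α b ω j β λ j≡i → contradiction j≡i j≢i)
    ... | _        | no β≢α   = trans (table-shift-minimal i α b (shift i α b ω) j β λ _ → β≢α)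
                                      (table-shift-minimal i α b ω j β λ _ → β≢α)

  shift-permutation : Fin c → Fin s → Bin → Permutation′ #Ω
  shift-permutation i α b = permutation (shift i α b) (shift i α b) (shift-involutive i α b) (shift-involutive i α b)

  private
    foldr-⊕-cong : {t u : Vector Bin c} → t ≗ u → foldr (_⊕_ {r}) (0ʳ {r}) t ≡ foldr (_⊕_ {r}) (0ʳ {r}) u
    foldr-⊕-cong = Pointwise.foldr-cong {R = _≡_} {S = _≡_} (cong₂ (_⊕_ {r})) refl

  -- The key reads the entry `(i , α)` exactly once, in position `i`; the other positions read other
  -- tables.
  hash-shift : ∀ {i α} b ω x → x [ i ] ≡ α → hash (shift i α b ω) x ≡ _⊕_ {r} (hash ω x) b
  hash-shift {i} b ω x refl = trans (foldr-⊕-cong entry) (foldr-⊕-updateAt {r} (λ j → table ω j (x [ j ])) i b)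
    where
    entry : ∀ j → table (shift i (x [ i ]) b ω) j (x [ j ]) ≡ updateAt (λ j → table ω j (x [ j ])) i (λ v → _⊕_ {r} v b) j
    entry j with j ≟ i
    ... | yes refl = trans (table-shift i (x [ i ]) b ω) (sym (updateAt-updates i _))
    ... | no  j≢i  = trans (table-shift-minimal i (x [ i ]) b ω j (x [ j ]) (λ j≡i → contradiction j≡i j≢i))
                           (sym (updateAt-minimal j i _ j≢i))

  hash-shift-minimal : ∀ {i α} b ω x → x [ i ] ≢ α → hash (shift i α b ω) x ≡ hash ω x
  hash-shift-minimal b ω x ≢α = foldr-⊕-cong λ j →
    table-shift-minimal _ _ b ω j (x [ j ]) λ { refl → ≢α }

  -- Independence from a table entry.

  -- Expresses that `P` does not depend on the table entry `(i , α)`.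
  Invariant : Fin c → Fin s → (Ω → ℚ) → Set
  Invariant i α P = ∀ b ω → P (shift i α b ω) ≡ P ω

  hit : Bin → Key → Ω → ℚ
  hit y x ω = 𝟙 (hash ω x ≟ y)

  hit-invariant : ∀ {i α} y x → x [ i ] ≢ α → Invariant i α (hit y x)
  hit-invariant y x ≢α b ω = cong (λ z → 𝟙 (z ≟ y)) (hash-shift-minimal b ω x ≢α)

  *-invariant : ∀ {i α P Q} → Invariant i α P → Invariant i α Q → Invariant i α (λ ω → P ω * Q ω)
  *-invariant P-inv Q-inv b ω = cong₂ _*_ (P-inv b ω) (Q-inv b ω)

  ∑-hit : ∀ x ω → ∑ (λ y → hit y x ω) ≡ 1ℚ
  ∑-hit x ω = ∑-indicator (hash ω x)
    where
    ∑-indicator : ∀ {n} (z : Fin n) → ∑ (λ y → 𝟙 (z ≟ y)) ≡ 1ℚ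
    ∑-indicator {suc n} zero = trans (cong (_+_ 1ℚ) (trans (∑-const n 0ℚ) (ℚ.*-zeroʳ (fromℕ n)))) (ℚ.+-identityʳ 1ℚ)
    ∑-indicator (suc z) = trans (ℚ.+-identityˡ _) (trans (∑-cong (λ y → 𝟙-cong (suc z ≟ suc y) (z ≟ y) Fin.suc-injective (cong suc))) (∑-indicator z))

  -- Shifting the entry `(i , x [ i ])` by `y ⊕ y′` turns the event that `x` lands in `y` into the
  -- event that it lands in `y′`, and leaves `P` unchanged.
  𝔼-hit-symmetric : ∀ {i P} x → Invariant i (x [ i ]) P → ∀ y y′ →
    𝔼 (λ ω → P ω * hit y x ω) ≡ 𝔼 (λ ω → P ω * hit y′ x ω)
  𝔼-hit-symmetric {i} {P} x P-inv y y′ = begin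
    𝔼 (λ ω → P ω * hit y x ω)               ≡⟨ 𝔼-permute (shift-permutation i (x [ i ]) b) (λ ω → P ω * hit y x ω) ⟨
    𝔼 (λ ω → P (shift i (x [ i ]) b ω) * hit y x (shift i (x [ i ]) b ω))
                                            ≡⟨ 𝔼-cong (λ ω → cong₂ _*_ (P-inv b ω) (hit-shift ω)) ⟩
    𝔼 (λ ω → P ω * hit y′ x ω)              ∎
    where
    open ≡-Reasoning
    b = _⊕_ {r} y y′
    hit-shift : ∀ ω → hit y x (shift i (x [ i ]) b ω) ≡ hit y′ x ω
    hit-shift ω = trans (cong (λ z → 𝟙 (z ≟ y)) (hash-shift {i} b ω x refl)) (𝟙-cong (_ ≟ y) (hash ω x ≟ y′)
      (λ h⊕b≡y → trans (sym (⊕-cancel {r} (hash ω x) b)) (trans (cong (λ z → _⊕_ {r} z b) h⊕b≡y)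
        (trans (cong (_⊕_ {r} y) (⊕-comm {r} y y′)) (a⊕[b⊕a]≡b {r} y y′))))
      (λ { refl → a⊕[b⊕a]≡b {r} y′ y }))

  -- By symmetry all `n` bins give the same value, and these values add up to `𝔼 P` because `x`
  -- lands in exactly one bin. So `x` hits `y` with probability 1/n, independently of anything that
  -- ignores one of its table entries.
  𝔼-fresh : ∀ {i P} x → Invariant i (x [ i ]) P → ∀ y → 𝔼 (λ ω → P ω * hit y x ω) ≡ ν * 𝔼 P
  𝔼-fresh {i} {P} x P-inv y = begin
    Q                                                   ≡⟨ ℚ.*-identityˡ Q ⟨
    1ℚ * Q                                              ≡⟨ cong (_* Q) (sym ν*n≡1) ⟩
    ν * fromℕ n * Q                                     ≡⟨ ℚ.*-assoc ν (fromℕ n) Q ⟩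
    ν * (fromℕ n * Q)                                   ≡⟨ cong (ν *_) (begin
      fromℕ n * Q                                       ≡⟨ ∑-const n Q ⟨
      ∑ {n} (λ _ → Q)                                   ≡⟨ ∑-cong {n} (λ y′ → 𝔼-hit-symmetric {i} {P} x P-inv y y′) ⟩
      ∑ (λ y′ → 𝔼 (λ ω → P ω * hit y′ x ω))             ≡⟨ 𝔼-∑ (λ ω y′ → P ω * hit y′ x ω) ⟨
      𝔼 (λ ω → ∑ (λ y′ → P ω * hit y′ x ω))             ≡⟨ 𝔼-cong (λ ω → trans (sym (∑-* (P ω) (λ y′ → hit y′ x ω)))
                                                             (trans (cong (P ω *_) (∑-hit x ω)) (ℚ.*-identityʳ (P ω)))) ⟩
      𝔼 P                                               ∎) ⟩
    ν * 𝔼 P                                             ∎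
    where
    open ≡-Reasoning
    Q = 𝔼 (λ ω → P ω * hit y x ω)

  -- Missing and hitting a bin.

  -- The indicator that no key of `xs` lands in `y`. The product form allows single keys to be split
  -- off and the order to be changed.
  miss : Bin → List Key → Ω → ℚ
  miss y []       ω = 1ℚ
  miss y (x ∷ xs) ω = (1ℚ - hit y x ω) * miss y xs ω

  0≤hit : ∀ y x ω → 0ℚ ≤ hit y x ω
  0≤hit y x ω = 0≤𝟙 (hash ω x ≟ y)

  0≤1-hit : ∀ y x ω → 0ℚ ≤ 1ℚ - hit y x ω
  0≤1-hit y x ω = p≤q⇒0≤q-p (𝟙≤1 (hash ω x ≟ y))

  1-hit≤1 : ∀ y x ω → 1ℚ - hit y x ω ≤ 1ℚ
  1-hit≤1 y x ω = 0≤q-p⇒p≤q (subst (0ℚ ≤_) (solve 1 (λ e → e := con 1ℚ :- (con 1ℚ :- e)) refl (hit y x ω)) (0≤hit y x ω))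
    where open +-*-Solver

  0≤miss : ∀ y xs ω → 0ℚ ≤ miss y xs ω
  0≤miss y []       ω = ℚ.nonNegative⁻¹ 1ℚ
  0≤miss y (x ∷ xs) ω = 0≤p*q (0≤1-hit y x ω) (0≤miss y xs ω)

  miss-∷-≤ : ∀ y x xs ω → miss y (x ∷ xs) ω ≤ miss y xs ω
  miss-∷-≤ y x xs ω = subst (miss y (x ∷ xs) ω ≤_) (ℚ.*-identityˡ _) (*-monoʳ-≤ (0≤miss y xs ω) (1-hit≤1 y x ω))

  miss≤1 : ∀ y xs ω → miss y xs ω ≤ 1ℚ
  miss≤1 y []       ω = ℚ.≤-refl
  miss≤1 y (x ∷ xs) ω = ℚ.≤-trans (miss-∷-≤ y x xs ω) (miss≤1 y xs ω)

  miss-↭ : ∀ y {xs ys} → xs ↭ ys → ∀ ω → miss y xs ω ≡ miss y ys ω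
  miss-↭ y ↭.refl              ω = refl
  miss-↭ y (↭.prep x p)        ω = cong ((1ℚ - hit y x ω) *_) (miss-↭ y p ω)
  miss-↭ y (↭.swap {xs} x x′ p) ω = trans
    (solve 3 (λ a b m → a :* (b :* m) := b :* (a :* m)) refl (1ℚ - hit y x ω) (1ℚ - hit y x′ ω) (miss y xs ω))
    (cong (λ m → (1ℚ - hit y x′ ω) * ((1ℚ - hit y x ω) * m)) (miss-↭ y p ω))
    where open +-*-Solver
  miss-↭ y (↭.trans p q)       ω = trans (miss-↭ y p ω) (miss-↭ y q ω)

  sharing without : Fin c → Fin s → List Key → List Key
  sharing i α = filter (λ x → x [ i ] ≟ α)
  without i α = filter (λ x → ¬? (x [ i ] ≟ α))

  hits : Bin → List Key → Ω → ℚ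
  hits y []       ω = 0ℚ
  hits y (x ∷ xs) ω = hit y x ω + hits y xs ω

  0≤hits : ∀ y xs ω → 0ℚ ≤ hits y xs ω
  0≤hits y []       ω = ℚ.≤-refl
  0≤hits y (x ∷ xs) ω = ℚ.+-mono-≤ (0≤hit y x ω) (0≤hits y xs ω)

  miss-invariant : ∀ y {i α xs} → All (λ x → x [ i ] ≢ α) xs → Invariant i α (miss y xs)
  miss-invariant y []                b ω = refl
  miss-invariant y (_∷_ {x} x≢α ≢αs) b ω =
    cong₂ (λ e m → (1ℚ - e) * m) (hit-invariant y x x≢α b ω) (miss-invariant y ≢αs b ω)

  miss≤miss-without : ∀ y i α xs ω → miss y xs ω ≤ miss y (without i α xs) ω
  miss≤miss-without y i α []       ω = ℚ.≤-refl
  miss≤miss-without y i α (x ∷ xs) ω with x [ i ] ≟ α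
  ... | yes _ = ℚ.≤-trans (miss-∷-≤ y x xs ω) (miss≤miss-without y i α xs ω)
  ... | no  _ = *-monoˡ-≤ (0≤1-hit y x ω) (miss≤miss-without y i α xs ω)

  -- Union bound: putting back the keys with character `α` in position `i` changes the indicator
  -- only if one of them lands in `y`. Together with `miss≤miss-without` it encloses the indicator
  -- between two tractable quantities.
  miss-without≤miss+hits : ∀ y i α xs ω → miss y (without i α xs) ω ≤ miss y xs ω + hits y (sharing i α xs) ω
  miss-without≤miss+hits y i α []       ω = ℚ.≤-reflexive (sym (ℚ.+-identityʳ 1ℚ))
  miss-without≤miss+hits y i α (x ∷ xs) ω with ih ← miss-without≤miss+hits y i α xs ω | x [ i ] ≟ α
  ... | yes _ = begin
    miss y (without i α xs) ω                 ≤⟨ ih ⟩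
    m + H                                     ≡⟨ solve 3 (λ e m h → m :+ h := (con 1ℚ :- e) :* m :+ (e :* m :+ h)) refl e m H ⟩
    (1ℚ - e) * m + (e * m + H)                ≤⟨ ℚ.+-monoʳ-≤ ((1ℚ - e) * m) (ℚ.+-monoˡ-≤ H (*-monoˡ-≤ (0≤hit y x ω) (miss≤1 y xs ω))) ⟩
    (1ℚ - e) * m + (e * 1ℚ + H)               ≡⟨ cong (λ e′ → (1ℚ - e) * m + (e′ + H)) (ℚ.*-identityʳ e) ⟩
    (1ℚ - e) * m + (e + H)                    ∎
    where
    open ℚ.≤-Reasoning
    open +-*-Solver
    e = hit y x ω
    m = miss y xs ω
    H = hits y (sharing i α xs) ω
  ... | no  _ = begin
    (1ℚ - e) * miss y (without i α xs) ω      ≤⟨ *-monoˡ-≤ (0≤1-hit y x ω) ih ⟩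
    (1ℚ - e) * (m + H)                        ≡⟨ ℚ.*-distribˡ-+ (1ℚ - e) m H ⟩
    (1ℚ - e) * m + (1ℚ - e) * H               ≤⟨ ℚ.+-monoʳ-≤ ((1ℚ - e) * m) (*-monoʳ-≤ (0≤hits y (sharing i α xs) ω) (1-hit≤1 y x ω)) ⟩
    (1ℚ - e) * m + 1ℚ * H                     ≡⟨ cong (_+_ ((1ℚ - e) * m)) (ℚ.*-identityˡ H) ⟩
    (1ℚ - e) * m + H                          ∎
    where
    open ℚ.≤-Reasoning
    e = hit y x ω
    m = miss y xs ω
    H = hits y (sharing i α xs) ω

  -- Weighted expectations of hits.

  -- The weight `W` treats both cases at once: it will be the constant 1, or the indicator that `q`
  -- hashes to `z`. The latter reads only the table entries of `q`, hence the invariance at free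
  -- characters.
  module _ (q : Maybe Key) (W : Ω → ℚ) (0≤W : ∀ ω → 0ℚ ≤ W ω)
    (W-inv : ∀ {i α} → Free q i α → Invariant i α W) where

    private
      w : ℚ
      w = 𝔼 W

    𝔼-hit : ∀ {i} x → Free q i (x [ i ]) → ∀ y → 𝔼 (λ ω → W ω * hit y x ω) ≡ ν * w
    𝔼-hit {i} x free = 𝔼-fresh {i} {W} x (W-inv free)

    private
      -- The entry `(j , x [ j ])` is read neither by `x′` nor by `W`, so `x` contributes one factor
      -- `ν`; the free entry of `x′` contributes the other.
      𝔼-hit-hit-free : ∀ {i j} x x′ y → Free q i (x′ [ i ]) → Free q j (x [ j ]) → x′ [ j ] ≢ x [ j ] →
        𝔼 (λ ω → W ω * hit y x′ ω * hit y x ω) ≡ ν * (ν * w)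
      𝔼-hit-hit-free {i} {j} x x′ y free-i free-j ≢ = trans
        (𝔼-fresh {j} {λ ω → W ω * hit y x′ ω} x
          (*-invariant {P = W} {Q = hit y x′} (W-inv free-j) (hit-invariant y x′ ≢)) y)
        (cong (ν *_) (𝔼-hit x′ free-i y))

    -- Two distinct keys sharing a free character differ in another position, where at least
    -- one of their two characters is free.
    𝔼-hit-hit : ∀ {i} {x x′} y → Free q i (x [ i ]) → x′ [ i ] ≡ x [ i ] → x ≢ x′ →
      𝔼 (λ ω → W ω * hit y x′ ω * hit y x ω) ≡ ν * (ν * w)
    𝔼-hit-hit {i} {x} {x′} y free x′ᵢ≡xᵢ x≢x′ = cases (free? q j (x [ j ])) (free? q j (x′ [ j ]))
      where
      open +-*-Solver
      ∃-differ : ∃ λ j → x [ j ] ≢ x′ [ j ]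
      ∃-differ = ¬∀⟶∃¬ c _ (λ j → x [ j ] ≟ x′ [ j ]) (x≢x′ ∘ finToFun-injective {s} {c})
      j = proj₁ ∃-differ
      xⱼ≢x′ⱼ = proj₂ ∃-differ
      cases : Dec (Free q j (x [ j ])) → Dec (Free q j (x′ [ j ])) →
        𝔼 (λ ω → W ω * hit y x′ ω * hit y x ω) ≡ ν * (ν * w)
      cases (yes free-j) _            = 𝔼-hit-hit-free x x′ y (subst (Free q i) (sym x′ᵢ≡xᵢ) free) free-j (xⱼ≢x′ⱼ ∘ sym)
      cases (no _)       (yes free-j) = trans
        (𝔼-cong (λ ω → solve 3 (λ w a b → w :* a :* b := w :* b :* a) refl (W ω) (hit y x′ ω) (hit y x ω)))
        (𝔼-hit-hit-free x′ x y free free-j xⱼ≢x′ⱼ)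
      cases (no ¬f)      (no ¬f′)     = contradiction (¬free-unique q ¬f ¬f′) xⱼ≢x′ⱼ

    private
      fromℕ-suc-* : ∀ k p → fromℕ (suc k) * p ≡ p + fromℕ k * p
      fromℕ-suc-* k p = trans (cong (_* p) (fromℕ-+ 1 k))
        (trans (ℚ.*-distribʳ-+ p 1ℚ (fromℕ k)) (cong (_+ fromℕ k * p) (ℚ.*-identityˡ p)))

    𝔼-hits : ∀ y {i xs} → All (λ x → Free q i (x [ i ])) xs →
      𝔼 (λ ω → W ω * hits y xs ω) ≡ fromℕ (length xs) * (ν * w)
    𝔼-hits y []                        = trans (𝔼-cong (λ ω → ℚ.*-zeroʳ (W ω))) (trans (𝔼-const {#Ω} 0ℚ) (sym (ℚ.*-zeroˡ (ν * w))))
    𝔼-hits y (_∷_ {x} {xs} free frees) = begin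
      𝔼 (λ ω → W ω * (hit y x ω + hits y xs ω))                     ≡⟨ 𝔼-cong (λ ω → ℚ.*-distribˡ-+ (W ω) (hit y x ω) (hits y xs ω)) ⟩
      𝔼 (λ ω → W ω * hit y x ω + W ω * hits y xs ω)                 ≡⟨ 𝔼-+ (λ ω → W ω * hit y x ω) (λ ω → W ω * hits y xs ω) ⟩
      𝔼 (λ ω → W ω * hit y x ω) + 𝔼 (λ ω → W ω * hits y xs ω)       ≡⟨ cong₂ _+_ (𝔼-hit x free y) (𝔼-hits y frees) ⟩
      ν * w + fromℕ (length xs) * (ν * w)                           ≡⟨ fromℕ-suc-* (length xs) (ν * w) ⟨
      fromℕ (suc (length xs)) * (ν * w)                             ∎
      where open ≡-Reasoning

    𝔼-hits-hit : ∀ y {i x xs} → Free q i (x [ i ]) → All (λ x′ → x′ [ i ] ≡ x [ i ]) xs → x ∉ xs →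
      𝔼 (λ ω → W ω * hits y xs ω * hit y x ω) ≡ fromℕ (length xs) * (ν * (ν * w))
    𝔼-hits-hit y {i} {x} free [] x∉ = trans
      (𝔼-cong (λ ω → solve 2 (λ w e → w :* con 0ℚ :* e := con 0ℚ) refl (W ω) (hit y x ω)))
      (trans (𝔼-const {#Ω} 0ℚ) (sym (ℚ.*-zeroˡ (ν * (ν * w)))))
      where open +-*-Solver
    𝔼-hits-hit y {i} {x} free (_∷_ {x′} {xs} eq eqs) x∉ = begin
      𝔼 (λ ω → W ω * (hit y x′ ω + H ω) * hit y x ω)
        ≡⟨ 𝔼-cong (λ ω → solve 4 (λ w a h e → w :* (a :+ h) :* e := w :* a :* e :+ w :* h :* e) refl (W ω) (hit y x′ ω) (H ω) (hit y x ω)) ⟩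
      𝔼 (λ ω → W ω * hit y x′ ω * hit y x ω + W ω * H ω * hit y x ω)
        ≡⟨ 𝔼-+ (λ ω → W ω * hit y x′ ω * hit y x ω) (λ ω → W ω * H ω * hit y x ω) ⟩
      𝔼 (λ ω → W ω * hit y x′ ω * hit y x ω) + 𝔼 (λ ω → W ω * H ω * hit y x ω)
        ≡⟨ cong₂ _+_ (𝔼-hit-hit y free eq (x∉ ∘ here)) (𝔼-hits-hit y free eqs (x∉ ∘ there)) ⟩
      ν * (ν * w) + fromℕ (length xs) * (ν * (ν * w))
        ≡⟨ fromℕ-suc-* (length xs) (ν * (ν * w)) ⟨
      fromℕ (suc (length xs)) * (ν * (ν * w)) ∎
      where
      open ≡-Reasoning
      open +-*-Solver
      H = hits y xs

    -- The probability of missing a bin, one key at a time.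

    avoid : Bin → List Key → ℚ
    avoid y xs = 𝔼 (λ ω → W ω * miss y xs ω)

    -- Write the left term as `A - B`, where `B` also requires `x` to hit `y`. Without the keys
    -- sharing the character `x [ i ]`, the analogue of `B` is exactly `ν * A′`. Putting the `k`
    -- sharing keys back costs at most `k · ν · w` in `A′` and, as pairs collide in `y` with weight
    -- `ν² w`, at most `h` in `ν * A′`. Each cost bounds one sign of the difference.
    avoid-∷ : ∀ y i x xs → Free q i (x [ i ]) → x ∉ xs →
      abs (avoid y (x ∷ xs) - ρ * avoid y xs) ≤ fromℕ (count i (x [ i ]) xs) * (ν * (ν * w))
    avoid-∷ y i x xs free x∉ = ∣p∣≤q
      (begin
        avoid y (x ∷ xs) - (1ℚ - ν) * A   ≡⟨ cong (_- (1ℚ - ν) * A) split ⟩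
        (A - B) - (1ℚ - ν) * A            ≡⟨ solve 3 (λ ν a b → (a :- b) :- (con 1ℚ :- ν) :* a := ν :* a :- b) refl ν A B ⟩
        ν * A - B                         ≤⟨ ℚ.+-monoˡ-≤ (- B) (*-monoˡ-≤ 0≤ν A≤A′) ⟩
        ν * A′ - B                        ≤⟨ ℚ.+-monoˡ-≤ (- B) νA′≤B+h ⟩
        (B + h) - B                       ≡⟨ solve 2 (λ b h → (b :+ h) :- b := h) refl B h ⟩
        h                                 ∎)
      (begin
        - (avoid y (x ∷ xs) - (1ℚ - ν) * A)  ≡⟨ cong (λ z → - (z - (1ℚ - ν) * A)) split ⟩
        - ((A - B) - (1ℚ - ν) * A)           ≡⟨ solve 3 (λ ν a b → :- ((a :- b) :- (con 1ℚ :- ν) :* a) := b :- ν :* a) refl ν A B ⟩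
        B - ν * A                            ≤⟨ ℚ.+-monoˡ-≤ (- (ν * A)) B≤νA′ ⟩
        ν * A′ - ν * A                       ≤⟨ ℚ.+-monoˡ-≤ (- (ν * A)) (*-monoˡ-≤ 0≤ν A′≤A+h) ⟩
        ν * (A + k * (ν * w)) - ν * A        ≡⟨ solve 4 (λ ν a k w → ν :* (a :+ k :* (ν :* w)) :- ν :* a := k :* (ν :* (ν :* w))) refl ν A k w ⟩
        h                                    ∎)
      where
      open ℚ.≤-Reasoning
      open +-*-Solver
      α = x [ i ]
      k = fromℕ (count i α xs)
      h = k * (ν * (ν * w))
      shared : All (λ x′ → x′ [ i ] ≡ α) (sharing i α xs)
      shared = All.all-filter (λ x′ → x′ [ i ] ≟ α) xs
      e m m′ H : Ω → ℚ
      e = hit y x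
      m = miss y xs
      m′ = miss y (without i α xs)
      H = hits y (sharing i α xs)
      A = avoid y xs
      A′ = avoid y (without i α xs)
      B = 𝔼 (λ ω → W ω * m ω * e ω)

      split : avoid y (x ∷ xs) ≡ A - B
      split = trans (𝔼-cong (λ ω → solve 3 (λ w e m → w :* ((con 1ℚ :- e) :* m) := w :* m :- w :* m :* e) refl (W ω) (e ω) (m ω)))
        (𝔼-− (λ ω → W ω * m ω) _)

      fresh : 𝔼 (λ ω → W ω * m′ ω * e ω) ≡ ν * A′
      fresh = 𝔼-fresh {i} {λ ω → W ω * m′ ω} x (*-invariant {P = W} {Q = m′} (W-inv free) (miss-invariant y (All.all-filter (λ x′ → ¬? (x′ [ i ] ≟ α)) xs))) y

      A≤A′ : A ≤ A′
      A≤A′ = 𝔼-mono (λ ω → *-monoˡ-≤ (0≤W ω) (miss≤miss-without y i α xs ω))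

      B≤νA′ : B ≤ ν * A′
      B≤νA′ = subst (B ≤_) fresh
        (𝔼-mono (λ ω → *-monoʳ-≤ (0≤hit y x ω) (*-monoˡ-≤ (0≤W ω) (miss≤miss-without y i α xs ω))))

      A′≤A+h : A′ ≤ A + k * (ν * w)
      A′≤A+h = begin
        A′                                     ≤⟨ 𝔼-mono (λ ω → *-monoˡ-≤ (0≤W ω) (miss-without≤miss+hits y i α xs ω)) ⟩
        𝔼 (λ ω → W ω * (m ω + H ω))            ≡⟨ 𝔼-cong (λ ω → ℚ.*-distribˡ-+ (W ω) (m ω) (H ω)) ⟩
        𝔼 (λ ω → W ω * m ω + W ω * H ω)        ≡⟨ 𝔼-+ (λ ω → W ω * m ω) (λ ω → W ω * H ω) ⟩
        A + 𝔼 (λ ω → W ω * H ω)                ≡⟨ cong (_+_ A) (𝔼-hits y (All.map (λ eq → subst (Free q i) (sym eq) free) shared)) ⟩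
        A + k * (ν * w)                        ∎

      νA′≤B+h : ν * A′ ≤ B + h
      νA′≤B+h = begin
        ν * A′                                                ≡⟨ fresh ⟨
        𝔼 (λ ω → W ω * m′ ω * e ω)                            ≤⟨ 𝔼-mono (λ ω → *-monoʳ-≤ (0≤hit y x ω) (*-monoˡ-≤ (0≤W ω) (miss-without≤miss+hits y i α xs ω))) ⟩
        𝔼 (λ ω → W ω * (m ω + H ω) * e ω)                     ≡⟨ 𝔼-cong (λ ω → solve 4 (λ w m h e → w :* (m :+ h) :* e := w :* m :* e :+ w :* h :* e) refl (W ω) (m ω) (H ω) (e ω)) ⟩
        𝔼 (λ ω → W ω * m ω * e ω + W ω * H ω * e ω)           ≡⟨ 𝔼-+ (λ ω → W ω * m ω * e ω) (λ ω → W ω * H ω * e ω) ⟩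
        B + 𝔼 (λ ω → W ω * H ω * e ω)                         ≡⟨ cong (_+_ B) (𝔼-hits-hit y free shared (x∉ ∘ proj₁ ∘ ∈-filter⁻ (λ x′ → x′ [ i ] ≟ α))) ⟩
        B + h                                                 ∎

    -- D plays the role of suc ∣ q ∣? · k^(1-1/c).
    Bounded : ℕ → List Key → Set
    Bounded k xs = ∃ λ D → D ℕ.^ c ℕ.≤ suc ∣ q ∣? ℕ.^ c ℕ.* k ℕ.^ ℕ.pred c ×
      ∀ y → abs (avoid y xs - w * ρ ^ℚ k) ≤ fromℕ (k ℕ.* D) * (ν * (ν * w))

    bounded-[] : .{{NonZero c}} → Bounded 0 []
    -- Rewriting `c` as a successor makes `0 ^ c` compute to 0.
    bounded-[] = 0 , subst (λ l → 0 ℕ.^ l ℕ.≤ suc ∣ q ∣? ℕ.^ c ℕ.* 0 ℕ.^ ℕ.pred c) (ℕ.suc-pred c) ℕ.z≤n , λ y → ℚ.≤-reflexive (begin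
      abs (avoid y [] - w * 1ℚ)       ≡⟨ cong (λ z → abs (z - w * 1ℚ)) (𝔼-cong (λ ω → ℚ.*-identityʳ (W ω))) ⟩
      abs (w - w * 1ℚ)                ≡⟨ cong abs (solve 1 (λ w → w :- w :* con 1ℚ := con 0ℚ) refl w) ⟩
      0ℚ                              ≡⟨ ℚ.*-zeroˡ (ν * (ν * w)) ⟨
      0ℚ * (ν * (ν * w))              ∎)
      where
      open ≡-Reasoning
      open +-*-Solver

    -- The new error is at most `a` units of `δ`, and the old one at most `k * D`; both fit into
    -- `suc k` copies of the maximum of `D` and `a`. The maximum keeps the witness an integer,
    -- although the intended `k^(1-1/c)` may be irrational.
    bounded-↭-∷ : ∀ {k xs x i ys} → xs ↭ x ∷ ys → x ∉ ys → Free q i (x [ i ]) →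
      count i (x [ i ]) xs ℕ.^ c ℕ.≤ suc ∣ q ∣? ℕ.^ c ℕ.* suc k ℕ.^ ℕ.pred c → Bounded k ys → Bounded (suc k) xs
    bounded-↭-∷ {k} {xs} {x} {i} {ys} perm x∉ys free rare (D , D-bound , ih) = D ℕ.⊔ a , D⊔a-bound , bound
      where
      open ℚ.≤-Reasoning
      a = count i (x [ i ]) xs
      κ = suc ∣ q ∣?
      δ = ν * (ν * w)

      D⊔a-bound : (D ℕ.⊔ a) ℕ.^ c ℕ.≤ κ ℕ.^ c ℕ.* suc k ℕ.^ ℕ.pred c
      D⊔a-bound = subst (ℕ._≤ κ ℕ.^ c ℕ.* suc k ℕ.^ ℕ.pred c)
        (sym (ℕ.mono-≤-distrib-⊔ (ℕ.^-monoˡ-≤ c) D a))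
        (ℕ.⊔-lub (ℕ.≤-trans D-bound (ℕ.*-monoʳ-≤ (κ ℕ.^ c) (ℕ.^-monoˡ-≤ (ℕ.pred c) (ℕ.n≤1+n k)))) rare)

      count≤a : count i (x [ i ]) ys ℕ.≤ a
      count≤a = ℕ.≤-trans (ℕ.n≤1+n _) (ℕ.≤-reflexive (trans (sym (count-∷ x ys)) (sym (↭-length (filter-↭ _ perm)))))
        where
        count-∷ : ∀ x ys → count i (x [ i ]) (x ∷ ys) ≡ suc (count i (x [ i ]) ys)
        count-∷ x ys with x [ i ] ≟ x [ i ]
        ... | yes _ = refl
        ... | no ≢ = contradiction refl ≢

      0≤ρ : 0ℚ ≤ ρ
      0≤ρ = p≤q⇒0≤q-p (1/n≤1 n)

      ρ≤1 : ρ ≤ 1ℚ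
      ρ≤1 = 0≤q-p⇒p≤q (subst (0ℚ ≤_) (solve 1 (λ e → e := con 1ℚ :- (con 1ℚ :- e)) refl ν) 0≤ν)
        where open +-*-Solver

      0≤δ : 0ℚ ≤ δ
      0≤δ = 0≤p*q 0≤ν (0≤p*q 0≤ν (0≤𝔼 0≤W))

      bound : ∀ y → abs (avoid y xs - w * ρ ^ℚ suc k) ≤ fromℕ (suc k ℕ.* (D ℕ.⊔ a)) * δ
      bound y = begin
        abs (avoid y xs - w * (ρ * ρ ^ℚ k))
          ≡⟨ cong (λ z → abs (z - w * (ρ * ρ ^ℚ k))) (𝔼-cong (λ ω → cong (W ω *_) (miss-↭ y perm ω))) ⟩
        abs (A′ - w * (ρ * ρ ^ℚ k))
          ≡⟨ cong abs (solve 5 (λ a′ a w ρ p → a′ :- w :* (ρ :* p) := (a′ :- ρ :* a) :+ ρ :* (a :- w :* p)) refl A′ A w ρ (ρ ^ℚ k)) ⟩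
        abs ((A′ - ρ * A) + ρ * (A - w * ρ ^ℚ k))
          ≤⟨ ℚ.∣p+q∣≤∣p∣+∣q∣ (A′ - ρ * A) (ρ * (A - w * ρ ^ℚ k)) ⟩
        abs (A′ - ρ * A) + abs (ρ * (A - w * ρ ^ℚ k))
          ≤⟨ ℚ.+-mono-≤ (avoid-∷ y i x ys free x∉ys) (begin
               abs (ρ * (A - w * ρ ^ℚ k))        ≡⟨ ℚ.∣p*q∣≡∣p∣*∣q∣ ρ (A - w * ρ ^ℚ k) ⟩
               abs ρ * abs (A - w * ρ ^ℚ k)      ≡⟨ cong (_* abs (A - w * ρ ^ℚ k)) (ℚ.0≤p⇒∣p∣≡p 0≤ρ) ⟩
               -- Earlier errors are not amplified, because `ρ ≤ 1`.
               ρ * abs (A - w * ρ ^ℚ k)          ≤⟨ *-monoʳ-≤ (ℚ.0≤∣p∣ (A - w * ρ ^ℚ k)) ρ≤1 ⟩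
               1ℚ * abs (A - w * ρ ^ℚ k)         ≡⟨ ℚ.*-identityˡ (abs (A - w * ρ ^ℚ k)) ⟩
               abs (A - w * ρ ^ℚ k)              ≤⟨ ih y ⟩
               fromℕ (k ℕ.* D) * δ               ∎) ⟩
        fromℕ b * δ + fromℕ (k ℕ.* D) * δ
          ≡⟨ ℚ.*-distribʳ-+ δ (fromℕ b) (fromℕ (k ℕ.* D)) ⟨
        (fromℕ b + fromℕ (k ℕ.* D)) * δ
          ≡⟨ cong (_* δ) (fromℕ-+ b (k ℕ.* D)) ⟨
        fromℕ (b ℕ.+ k ℕ.* D) * δ
          ≤⟨ *-monoʳ-≤ 0≤δ (fromℕ-mono-≤ (ℕ.+-mono-≤ (ℕ.≤-trans count≤a (ℕ.m≤n⊔m D a)) (ℕ.*-monoʳ-≤ k (ℕ.m≤m⊔n D a)))) ⟩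
        fromℕ (suc k ℕ.* (D ℕ.⊔ a)) * δ ∎
        where
        open +-*-Solver
        A′ = avoid y (x ∷ ys)
        A = avoid y ys
        b = count i (x [ i ]) ys

    -- Removes a rare key and recurses. The recursion is on the length `k`, since the list left
    -- after moving that key to the front is not a structural part of `xs`.
    avoid-bound : .{{NonZero c}} → ∀ k xs → length xs ≡ k → Unique xs →
      (∀ {x} → x ∈ xs → Maybe.All (_≢ x) q) → Bounded k xs
    avoid-bound zero    []         _   _    _    = bounded-[]
    avoid-bound (suc k) xs@(_ ∷ _) len uniq q∉xs = peel (∃-rare q uniq q∉xs)
      where
      peel : (∃₂ λ x i → x ∈ xs × Free q i (x [ i ]) ×
        count i (x [ i ]) xs ℕ.^ c ℕ.≤ suc ∣ q ∣? ℕ.^ c ℕ.* length xs ℕ.^ ℕ.pred c) → Bounded (suc k) xs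
      peel (x , i , x∈xs , free , rare) =
        bounded-↭-∷ perm (Unique.Unique[x∷xs]⇒x∉xs uniq′) free
          (subst (λ l → count i (x [ i ]) xs ℕ.^ c ℕ.≤ suc ∣ q ∣? ℕ.^ c ℕ.* l ℕ.^ ℕ.pred c) len rare)
          (avoid-bound k (as ++ bs) (ℕ.suc-injective (trans (sym (↭-length perm)) len)) (tail uniq′)
            (λ x∈ → q∉xs (∈-resp-↭ (↭-sym perm) (there x∈))))
        where
        as = proj₁ (∈-∃++ x∈xs)
        bs = proj₁ (proj₂ (∈-∃++ x∈xs))
        perm : xs ↭ x ∷ as ++ bs
        perm = subst (_↭ x ∷ as ++ bs) (sym (proj₂ (proj₂ (∈-∃++ x∈xs)))) (↭-shift x as bs)
        uniq′ : Unique (x ∷ as ++ bs)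
        uniq′ = Permutation.Unique-resp-↭ (≡.setoid Key) (↭⇒↭ₛ perm) uniq

  -- From missed bins to images.

  miss≡0 : ∀ {y x xs ω} → x ∈ xs → hash ω x ≡ y → miss y xs ω ≡ 0ℚ
  miss≡0 {y} {x} {_ ∷ xs} {ω} (here refl) hx≡y = trans (cong (λ e → (1ℚ - e) * miss y xs ω) (hit≡1 (hash ω x ≟ y)))
    (ℚ.*-zeroˡ (miss y xs ω))
    where
    hit≡1 : (d : Dec (hash ω x ≡ y)) → 𝟙 d ≡ 1ℚ
    hit≡1 (yes _) = refl
    hit≡1 (no ≢)  = contradiction hx≡y ≢
  miss≡0 {y} {x} {x′ ∷ xs} {ω} (there x∈xs) hx≡y = trans (cong ((1ℚ - hit y x′ ω) *_) (miss≡0 {xs = xs} x∈xs hx≡y))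
    (ℚ.*-zeroʳ (1ℚ - hit y x′ ω))

  miss≡1 : ∀ {y xs ω} → (∀ {x} → x ∈ xs → hash ω x ≢ y) → miss y xs ω ≡ 1ℚ
  miss≡1 {y} {[]}         ≢ = refl
  miss≡1 {y} {x ∷ xs} {ω} ≢ = cong₂ (λ e m → (1ℚ - e) * m) (hit≡0 (hash ω x ≟ y)) (miss≡1 {xs = xs} (≢ ∘ there))
    where
    hit≡0 : (d : Dec (hash ω x ≡ y)) → 𝟙 d ≡ 0ℚ
    hit≡0 (yes hx≡y) = contradiction hx≡y (≢ (here refl))
    hit≡0 (no _)     = refl

  𝟙-∈-image : ∀ X y ω → 𝟙 (y ∈? image (hash ω) X) ≡ 1ℚ - miss y (elements X) ω
  𝟙-∈-image X y ω = cases (y ∈? image (hash ω) X)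
    where
    cases : (d : Dec (y ∈ˢ image (hash ω) X)) → 𝟙 d ≡ 1ℚ - miss y (elements X) ω
    cases (yes y∈) = let x , x∈X , hx≡y = ∈-image⁻ (hash ω) X y∈ in
      cong (_-_ 1ℚ) (sym (miss≡0 {xs = elements X} (∈-elements⁺ x∈X) hx≡y))
    cases (no y∉)  = cong (_-_ 1ℚ) (sym (miss≡1 {xs = elements X}
      λ x∈ hx≡y → y∉ (∈-image⁺ (hash ω) X (∈-elements⁻ X x∈) hx≡y)))

  -- The unconditional bounds.

  module _ .{{_ : NonZero c}} (X : Subset (s ℕ.^ c)) where

    private
      m = ∣ X ∣
      xs = elements X

      scale : ∀ {t} B → t ≤ fromℕ B * (ν * (ν * 1ℚ)) → t * fromℕ (n ℕ.^ 2) ≤ fromℕ B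
      scale {t} B t≤ = begin
        t * fromℕ (n ℕ.^ 2)                             ≤⟨ *-monoʳ-≤ (0≤fromℕ (n ℕ.^ 2)) t≤ ⟩
        fromℕ B * (ν * (ν * 1ℚ)) * fromℕ (n ℕ.^ 2)      ≡⟨ cong (fromℕ B * (ν * (ν * 1ℚ)) *_) (fromℕ-^ n 2) ⟩
        fromℕ B * (ν * (ν * 1ℚ)) * (fromℕ n * (fromℕ n * 1ℚ))
          ≡⟨ solve 3 (λ b ν n → b :* (ν :* (ν :* con 1ℚ)) :* (n :* (n :* con 1ℚ)) := b :* ((ν :* n) :* (ν :* n))) refl (fromℕ B) ν (fromℕ n) ⟩
        fromℕ B * ((ν * fromℕ n) * (ν * fromℕ n))       ≡⟨ cong (λ z → fromℕ B * (z * z)) ν*n≡1 ⟩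
        fromℕ B * (1ℚ * 1ℚ)                             ≡⟨ ℚ.*-identityʳ (fromℕ B) ⟩
        fromℕ B                                         ∎
        where
        open ℚ.≤-Reasoning
        open +-*-Solver

      𝟏 : Ω → ℚ
      𝟏 _ = 1ℚ

      𝔼𝟏≡1 : 𝔼 𝟏 ≡ 1ℚ
      𝔼𝟏≡1 = 𝔼-const {#Ω} 1ℚ

      unconditional : Bounded nothing 𝟏 (λ _ → ℚ.nonNegative⁻¹ 1ℚ) (λ _ _ _ → refl) m xs
      unconditional = avoid-bound nothing 𝟏 (λ _ → ℚ.nonNegative⁻¹ 1ℚ) (λ _ _ _ → refl)
        m xs (length-elements X) (elements-unique X) (λ _ → nothing)

      D = proj₁ unconditional

    𝔼-*-𝟙-∈-image : ∀ (W : Ω → ℚ) y →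
      𝔼 (λ ω → W ω * 𝟙 (y ∈? image (hash ω) X)) ≡ 𝔼 W - 𝔼 (λ ω → W ω * miss y xs ω)
    𝔼-*-𝟙-∈-image W y = trans
      (𝔼-cong (λ ω → trans (cong (W ω *_) (𝟙-∈-image X y ω))
        (solve 2 (λ w m → w :* (con 1ℚ :- m) := w :- w :* m) refl (W ω) (miss y xs ω))))
      (𝔼-− W (λ ω → W ω * miss y xs ω))
      where open +-*-Solver

    Pr-bound : ∀ y → abs (Pr (λ ω → y ∈? image (hash ω) X) - p₀ n m) ≤ fromℕ (m ℕ.* D) * (ν * (ν * 1ℚ))
    Pr-bound y = begin
      abs (Pr (λ ω → y ∈? image (hash ω) X) - p₀ n m)   ≡⟨ cong (λ p → abs (p - p₀ n m)) pr ⟩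
      abs ((1ℚ - A) - (1ℚ - ρ ^ℚ m))                    ≡⟨ cong abs (solve 2 (λ a p → (con 1ℚ :- a) :- (con 1ℚ :- p) := :- (a :- con 1ℚ :* p)) refl A (ρ ^ℚ m)) ⟩
      abs (- (A - 1ℚ * ρ ^ℚ m))                         ≡⟨ ℚ.∣-p∣≡∣p∣ (A - 1ℚ * ρ ^ℚ m) ⟩
      abs (A - 1ℚ * ρ ^ℚ m)                             ≡⟨ cong (λ w → abs (A - w * ρ ^ℚ m)) 𝔼𝟏≡1 ⟨
      abs (A - 𝔼 𝟏 * ρ ^ℚ m)                            ≤⟨ proj₂ (proj₂ unconditional) y ⟩
      fromℕ (m ℕ.* D) * (ν * (ν * 𝔼 𝟏))                 ≡⟨ cong (λ w → fromℕ (m ℕ.* D) * (ν * (ν * w))) 𝔼𝟏≡1 ⟩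
      fromℕ (m ℕ.* D) * (ν * (ν * 1ℚ))                  ∎
      where
      open ℚ.≤-Reasoning
      open +-*-Solver
      A = 𝔼 (λ ω → 𝟏 ω * miss y xs ω)
      pr : Pr (λ ω → y ∈? image (hash ω) X) ≡ 1ℚ - A
      pr = trans (𝔼-cong (λ ω → sym (ℚ.*-identityˡ (𝟙 (y ∈? image (hash ω) X)))))
        (trans (𝔼-*-𝟙-∈-image 𝟏 y) (cong (_- A) 𝔼𝟏≡1))

    Pr-close : ∀ y → abs (Pr (λ ω → y ∈? image (hash ω) X) - p₀ n m) ≤ʳ m ^⟨ (2 ℕ.* c ℕ.∸ 1) / c ⟩ /ʳ (n ℕ.^ 2)
    Pr-close y = root-bound c 1 m D (proj₁ (proj₂ unconditional))
      (subst (_≤ fromℕ (m ℕ.* D)) (sym (ℚ.*-identityʳ _)) (scale (m ℕ.* D) (Pr-bound y)))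

    -- Linearity of expectation over the bins. The bounds can be added up because a single `D`,
    -- chosen before `y`, serves all bins.
    𝔼-∣image∣-close : abs (𝔼 (λ ω → fromℕ ∣ image (hash ω) X ∣) - μ₀ n m) ≤ʳ m ^⟨ (2 ℕ.* c ℕ.∸ 1) / c ⟩ /ʳ n
    𝔼-∣image∣-close = root-bound c 1 m D (proj₁ (proj₂ unconditional)) (begin
      abs (𝔼 (λ ω → fromℕ ∣ image (hash ω) X ∣) - μ₀ n m) * fromℕ n * 1ℚ
        ≡⟨ ℚ.*-identityʳ _ ⟩
      abs (𝔼 (λ ω → fromℕ ∣ image (hash ω) X ∣) - μ₀ n m) * fromℕ n
        ≡⟨ cong (λ z → abs z * fromℕ n) difference ⟩
      abs (∑ (λ y → p y - p₀ n m)) * fromℕ n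
        ≤⟨ *-monoʳ-≤ (0≤fromℕ n) (ℚ.≤-trans (∣∑∣≤∑∣∣ (λ y → p y - p₀ n m)) (∑-mono Pr-bound)) ⟩
      ∑ {n} (λ _ → b) * fromℕ n
        ≡⟨ cong (_* fromℕ n) (∑-const n b) ⟩
      fromℕ n * b * fromℕ n
        ≡⟨ solve 2 (λ n b → n :* b :* n := b :* (n :* (n :* con 1ℚ))) refl (fromℕ n) b ⟩
      b * (fromℕ n * (fromℕ n * 1ℚ))
        ≡⟨ cong (b *_) (fromℕ-^ n 2) ⟨
      b * fromℕ (n ℕ.^ 2)
        ≤⟨ scale (m ℕ.* D) ℚ.≤-refl ⟩
      fromℕ (m ℕ.* D) ∎)
      where
      open ℚ.≤-Reasoning
      open +-*-Solver
      b = fromℕ (m ℕ.* D) * (ν * (ν * 1ℚ))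
      p : Bin → ℚ
      p y = Pr (λ ω → y ∈? image (hash ω) X)
      difference : 𝔼 (λ ω → fromℕ ∣ image (hash ω) X ∣) - μ₀ n m ≡ ∑ (λ y → p y - p₀ n m)
      difference = begin-equality
        𝔼 (λ ω → fromℕ ∣ image (hash ω) X ∣) - μ₀ n m
          ≡⟨ cong (_- μ₀ n m) (trans (𝔼-cong (λ ω → sym (∑-∈ (image (hash ω) X)))) (𝔼-∑ (λ ω y → 𝟙 (y ∈? image (hash ω) X)))) ⟩
        ∑ p - fromℕ n * p₀ n m
          ≡⟨ cong (_+_ (∑ p)) (trans (ℚ.neg-distribʳ-* (fromℕ n) (p₀ n m)) (sym (∑-const n (- p₀ n m)))) ⟩
        ∑ p + ∑ {n} (λ _ → - p₀ n m)
          ≡⟨ ∑-+ p (λ _ → - p₀ n m) ⟨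
        ∑ (λ y → p y - p₀ n m) ∎

    -- The bound conditioned on the hash value of a query key.

    module _ (q : Key) (q∉X : q ∉ˢ X) (y z : Bin) where

      private
        W : Ω → ℚ
        W = hit z q

        W-inv : ∀ {i α} → Maybe.All (λ k → k [ i ] ≢ α) (just q) → Invariant i α W
        W-inv (just ≢α) = hit-invariant z q ≢α

        conditional : Bounded (just q) W (0≤hit z q) W-inv m xs
        conditional = avoid-bound (just q) W (0≤hit z q) W-inv m xs (length-elements X) (elements-unique X)
          (λ x∈xs → just λ { refl → q∉X (∈-elements⁻ X x∈xs) })

        D′ = proj₁ conditional

        w≡ν : 𝔼 W ≡ ν
        w≡ν = trans (𝔼-cong (λ ω → sym (ℚ.*-identityˡ (W ω))))
          -- Any position of `q` serves as the fresh one; position zero exists because `c` is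
          -- nonzero.
          (trans (𝔼-fresh {first c} {𝟏} q (λ _ _ → refl) z) (trans (cong (ν *_) 𝔼𝟏≡1) (ℚ.*-identityʳ ν)))
          where
          first : ∀ c .{{_ : NonZero c}} → Fin c
          first (suc c) = zero

        w≢0 : 𝔼 W ≢ 0ℚ
        w≢0 w≡0 = contradiction {A = 1ℚ ≡ 0ℚ} (trans (sym ν*n≡1) (trans (cong (_* fromℕ n) (trans (sym w≡ν) w≡0)) (ℚ.*-zeroˡ (fromℕ n)))) λ ()

        p = Pr[ (λ ω → y ∈? image (hash ω) X) ∣ (λ ω → hash ω q ≟ z) ]
        A = 𝔼 (λ ω → W ω * miss y xs ω)

        p*w : p * 𝔼 W ≡ 𝔼 W - A
        p*w = trans (Pr[∣]*Pr (λ ω → y ∈? image (hash ω) X) (λ ω → hash ω q ≟ z) w≢0)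
          (trans (𝔼-cong (λ ω → 𝟙-× (y ∈? image (hash ω) X) (hash ω q ≟ z))) (𝔼-*-𝟙-∈-image W y))

      -- Multiplying by the probability `ν` of the condition turns `p` into `𝔼 W - A`, to which the
      -- weighted estimate applies. The resulting error carries the same factor `ν`, which is then
      -- removed by multiplying by `n`.
      Pr[∣]-bound : abs (p - p₀ n m) ≤ fromℕ (m ℕ.* D′) * (ν * (ν * 1ℚ))
      Pr[∣]-bound = begin
        abs (p - p₀ n m)                                ≡⟨ ℚ.*-identityʳ _ ⟨
        abs (p - p₀ n m) * 1ℚ                           ≡⟨ cong (abs (p - p₀ n m) *_) ν*n≡1 ⟨
        abs (p - p₀ n m) * (ν * fromℕ n)                ≡⟨ ℚ.*-assoc (abs (p - p₀ n m)) ν (fromℕ n) ⟨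
        abs (p - p₀ n m) * ν * fromℕ n                  ≤⟨ *-monoʳ-≤ (0≤fromℕ n) weighted ⟩
        B * (ν * (ν * ν)) * fromℕ n                     ≡⟨ solve 3 (λ b ν n → b :* (ν :* (ν :* ν)) :* n := b :* (ν :* (ν :* (ν :* n)))) refl B ν (fromℕ n) ⟩
        B * (ν * (ν * (ν * fromℕ n)))                   ≡⟨ cong (λ z → B * (ν * (ν * z))) ν*n≡1 ⟩
        B * (ν * (ν * 1ℚ))                              ∎
        where
        open ℚ.≤-Reasoning
        open +-*-Solver
        B = fromℕ (m ℕ.* D′)
        weighted : abs (p - p₀ n m) * ν ≤ B * (ν * (ν * ν))
        weighted = begin
          abs (p - p₀ n m) * ν                  ≡⟨ cong (abs (p - p₀ n m) *_) (ℚ.0≤p⇒∣p∣≡p 0≤ν) ⟨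
          abs (p - p₀ n m) * abs ν              ≡⟨ ℚ.∣p*q∣≡∣p∣*∣q∣ (p - p₀ n m) ν ⟨
          abs ((p - p₀ n m) * ν)                ≡⟨ cong (λ w → abs ((p - p₀ n m) * w)) w≡ν ⟨
          abs ((p - p₀ n m) * 𝔼 W)              ≡⟨ cong abs (solve 3 (λ p r w → (p :- (con 1ℚ :- r)) :* w := p :* w :- (con 1ℚ :- r) :* w) refl p (ρ ^ℚ m) (𝔼 W)) ⟩
          abs (p * 𝔼 W - p₀ n m * 𝔼 W)          ≡⟨ cong (λ z → abs (z - p₀ n m * 𝔼 W)) p*w ⟩
          abs ((𝔼 W - A) - p₀ n m * 𝔼 W)        ≡⟨ cong abs (solve 3 (λ w a r → (w :- a) :- (con 1ℚ :- r) :* w := :- (a :- w :* r)) refl (𝔼 W) A (ρ ^ℚ m)) ⟩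
          abs (- (A - 𝔼 W * ρ ^ℚ m))            ≡⟨ ℚ.∣-p∣≡∣p∣ (A - 𝔼 W * ρ ^ℚ m) ⟩
          abs (A - 𝔼 W * ρ ^ℚ m)                ≤⟨ proj₂ (proj₂ conditional) y ⟩
          B * (ν * (ν * 𝔼 W))                   ≡⟨ cong (λ w → B * (ν * (ν * w))) w≡ν ⟩
          B * (ν * (ν * ν))                     ∎

      Pr[∣]-close : abs (p - p₀ n m) ≤ʳ (2 *ʳ m ^⟨ (2 ℕ.* c ℕ.∸ 1) / c ⟩) /ʳ (n ℕ.^ 2)
      -- Here `κ` is 2, the value of `suc ∣ just q ∣?`; it cancels the factor 1/2 into which `2 *ʳ`
      -- unfolds.
      Pr[∣]-close = root-bound c 2 m D′ (proj₁ (proj₂ conditional)) (begin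
        t * (+ 1 / 2) * fromℕ 2      ≡⟨ ℚ.*-assoc t (+ 1 / 2) (fromℕ 2) ⟩
        t * 1ℚ                       ≡⟨ ℚ.*-identityʳ t ⟩
        t                            ≤⟨ scale (m ℕ.* D′) Pr[∣]-bound ⟩
        fromℕ (m ℕ.* D′)             ∎)
        where
        open ℚ.≤-Reasoning
        t = abs (p - p₀ n m) * fromℕ (n ℕ.^ 2)

theorem1 : (c s r : ℕ) .{{_ : NonZero c}} →
    let open Tabulation c s r in
    (X : Subset (s ℕ.^ c)) (m : ℕ) → ∣ X ∣ ≡ m →
    let m^[2-1/c] = m ^⟨ (2 ℕ.* c ℕ.∸ 1) / c ⟩ in
    ((y : Bin) →
    abs (Pr (λ ω → y ∈? image (hash ω) X) - p₀ n m) ≤ʳ m^[2-1/c] /ʳ (n ℕ.^ 2))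
    × (abs (𝔼 (λ ω → fromℕ ∣ image (hash ω) X ∣) - μ₀ n m) ≤ʳ m^[2-1/c] /ʳ n)
    × ((q : Key) → q ∉ˢ X → (y : Bin → Bin) (z : Bin) →
    abs (Pr[ (λ ω → y z ∈? image (hash ω) X) ∣ (λ ω → hash ω q ≟ z) ] - p₀ n m)
    ≤ʳ (2 *ʳ m^[2-1/c]) /ʳ (n ℕ.^ 2))
-- Once `z` is fixed, `y z` is a fixed bin, so the conditional bound for a constant bin suffices.
theorem1 c s r X _ refl = Pr-close X , 𝔼-∣image∣-close X , λ q q∉X y z → Pr[∣]-close X q q∉X (y z) z
  where open SimpleTabulation c s r
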